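{- There is a function $g\colon \mathbb{N}\to\mathbb{R}$ with $g(n)=o(n)$ such that for every $n$, the WL dimension of every graph on $n$ vertices is at most $\frac{n}{4}+g(n)$.
   Context: Graphs are finite, simple and undirected with non-empty vertex set; a colored graph $(G,\chi)$ is a graph together with a map $\chi\colon V(G)\to C$, and an uncolored graph is regarded as a colored graph with all vertices of the same color. Isomorphisms of colored graphs must preserve colors. For $k\ge 1$, the $k$-dimensional Weisfeiler--Leman algorithm ($k$-WL) computes a coloring of $V(G)^k$ as follows. Initially, two $k$-tuples $(v_1,\dots,v_k)$ and $(w_1,\dots,w_k)$ (possibly from different colored graphs) get the same color iff $v_i\mapsto w_i$ is an isomorphism between the induced colored subgraphs on $\{v_1,\dots,v_k\}$ and $\{w_1,\dots,w_k\}$. In each round, for $k\ge 2$ the new color of $\bar v$ is the pair consisting of its old color and the multiset, over $w\in V(G)$, of the tuples (old color of $\bar v[w/1]$, \dots, old color of $\bar v[w/k]$), where $\bar v[w/i]$ replaces the $i$-th entry of $\bar v$ by $w$; for $k=1$ the new color of $v$ is the pair of its old color and the multiset of old colors of its neighbors. This is iterated until the induced partition no longer changes; the result is the stable coloring (colors are canonical, hence comparable across graphs). $k$-WL distinguishes two colored graphs if the multisets of stable colors of all $k$-tuples differ, and it identifies $(G,\chi)$ if it distinguishes $(G,\chi)$ from every colored graph not isomorphic to it. The WL dimension of $(G,\chi)$ is the least $k\ge1$ such that $k$-WL identifies $(G,\chi)$. -}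

module Defs where

open import Data.Nat using (ℕ; zero; suc; _≤_)
open import Data.Bool using (Bool; true; false)
open import Data.Fin using (Fin)
open import Data.Vec using (Vec; lookup; _[_]≔_)
open import Data.Product using (Σ; ∃; _×_; _,_)
open import Data.Empty using (⊥)
open import Relation.Nullary using (¬_)
open import Relation.Binary.PropositionalEquality using (_≡_)
open import Function.Bundles using (_↔_; Inverse)
open import Level using (0ℓ)

-- Colored graphs: finite, simple, undirected, non-empty vertex set Fin n,
-- colors taken from ℕ (a common color set, so colors are comparable
-- across graphs).

record ColoredGraph : Set where
  field
    n        : ℕ
    nonEmpty : 1 ≤ n
    adj      : Fin n → Fin n → Bool
    adj-sym  : ∀ x y → adj x y ≡ adj y x
    adj-irr  : ∀ x → adj x x ≡ false
    col      : Fin n → ℕ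

open ColoredGraph public

record Graph (n : ℕ) : Set where
  field
    adj      : Fin n → Fin n → Bool
    adj-sym  : ∀ x y → adj x y ≡ adj y x
    adj-irr  : ∀ x → adj x x ≡ false

toColored : ∀ {n} → 1 ≤ n → Graph n → ColoredGraph
toColored {n} ne G = record
  { n = n ; nonEmpty = ne ; adj = Graph.adj G ; adj-sym = Graph.adj-sym G
  ; adj-irr = Graph.adj-irr G ; col = λ _ → 0 }

Iso : ColoredGraph → ColoredGraph → Set
Iso G H = Σ (Fin (n G) ↔ Fin (n H)) λ f →
  (∀ x y → adj G x y ≡ adj H (Inverse.to f x) (Inverse.to f y)) ×
  (∀ x → col G x ≡ col H (Inverse.to f x))

Tuple : ℕ → ColoredGraph → Set
Tuple k G = Vec (Fin (n G)) k

-- Initial color equality: v_i ↦ w_i is an isomorphism of the induced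
-- colored subgraphs on {v_1..v_k} and {w_1..w_k}.
SameAtp : ∀ k (G H : ColoredGraph) → Tuple k G → Tuple k H → Set
SameAtp k G H v w =
  (∀ i j → (lookup v i ≡ lookup v j → lookup w i ≡ lookup w j) ×
           (lookup w i ≡ lookup w j → lookup v i ≡ lookup v j)) ×
  (∀ i j → adj G (lookup v i) (lookup v j) ≡ adj H (lookup w i) (lookup w j)) ×
  (∀ i → col G (lookup v i) ≡ col H (lookup w i))

N : (G : ColoredGraph) → Fin (n G) → Set
N G x = Σ (Fin (n G)) λ y → adj G x y ≡ true

-- SameCol k r G H v w : the k-WL colors of v (in G) and w (in H) after r
-- rounds coincide.  Equality of the multisets in the refinement step is
-- written out as existence of a bijection matching the elements.
SameCol : ∀ k → ℕ → (G H : ColoredGraph) → Tuple k G → Tuple k H → Set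
SameCol k zero G H v w = SameAtp k G H v w
SameCol (suc zero) (suc r) G H v w =
  SameCol 1 r G H v w ×
  Σ (N G (lookup v Fin.zero) ↔ N H (lookup w Fin.zero)) λ f →
    ∀ x → SameCol 1 r G H (Data.Vec.[ Σ.proj₁ x ]) (Data.Vec.[ Σ.proj₁ (Inverse.to f x) ])
  where import Data.Fin as Fin
        import Data.Vec
        import Data.Product as Σ
SameCol k (suc r) G H v w =
  SameCol k r G H v w ×
  Σ (Fin (n G) ↔ Fin (n H)) λ f →
    ∀ x → ∀ i → SameCol k r G H (v [ i ]≔ x) (w [ i ]≔ Inverse.to f x)

SameMultiset : ∀ k → ℕ → ColoredGraph → ColoredGraph → Set
SameMultiset k r G H = Σ (Tuple k G ↔ Tuple k H) λ F →
  ∀ v → SameCol k r G H v (Inverse.to F v)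

-- k-WL distinguishes G and H: at some round the color multisets differ
-- (equivalently, the multisets of stable colors differ).
Distinguishes : ℕ → ColoredGraph → ColoredGraph → Set
Distinguishes k G H = ∃ λ r → ¬ SameMultiset k r G H

Identifies : ℕ → ColoredGraph → Set
Identifies k G = ∀ (H : ColoredGraph) → ¬ Iso G H → Distinguishes k G H

-- "WL dimension of G is at most d" for a rational bound d: the least k ≥ 1
-- with Identifies k G is ≤ d, i.e. some k ≥ 1 with Identifies k G is ≤ d.

{-# OPTIONS --safe #-}
-- A position of the bijective pebble game is a list of pairs of vertices, and a set s of
-- pebbled vertices partitions V(G) into classes of vertices that k-WL cannot tell apart
-- over s.  First pebble o(n) vertices hitting all pairs of vertices whose neighbourhoods
-- differ in more than d places; then keep pebbling vertices that create at least four new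
-- classes, which happens at most n/4 times.  Now flip the adjacency between any two classes
-- that are mostly adjacent.  The resulting graph Γ has maximum degree at most 2d.  Pebbling x
-- splits the class of x and all neighbouring classes, so every class has at most two
-- neighbouring classes; and pebbling x splits by distance from x, so that either the component
-- of x in Γ has bounded radius or the class of x lies in a ball of bounded radius.  Hence each
-- component of Γ is small, in which case it can be pebbled entirely, or it is a path or cycle
-- of small classes, along which pebbles can be moved.  Isomorphisms obtained in this way for
-- the single components glue together.
module Submission where

open import Defs
open import Data.Nat using (ℕ; zero; suc; _≤_; _<_; z≤n; s≤s; _≤?_; NonZero; >-nonZero)
import Data.Nat as ℕ
open import Data.Nat.Properties hiding (_≟_)
open import Data.Nat.DivMod using (m≡m%n+[m/n]*n; m%n<n; m/n*n≤m)
open import Data.Nat.Tactic.RingSolver using (solve-∀)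
open import Data.Bool using (Bool; true; false; not; _xor_; _∧_)
open import Data.Bool.Properties using (∧-zeroʳ; T-≡; not-¬) renaming (_≟_ to _≟ᵇ_)
open import Data.Fin using (Fin; punchOut; fromℕ; fromℕ<; toℕ) renaming (zero to fz; suc to fs)
open import Data.Fin.Properties using (any?; pigeonhole; punchOut-injective; toℕ-fromℕ) renaming (_≟_ to _≟ᶠ_; <⇒≢ to <ᶠ⇒≢)
open import Data.Vec using (Vec; lookup; _[_]≔_; []; _∷_; replicate)
open import Data.Vec.Properties using (lookup∘update; lookup∘update′; lookup-replicate)
open import Data.List using (List; []; _∷_; _++_; length; map; filter; filterᵇ; allFin; tabulate; upTo; deduplicate; concatMap; cartesianProductWith; cartesianProduct)
open import Data.List.Properties using (++-assoc; ++-identityʳ; length-++; length-map; length-filter; length-tabulate; length-removeAt′)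
open import Data.List.Membership.Propositional using (_∈_; _∉_; lose; find)
open import Data.List.Membership.Propositional.Properties using (∈-allFin; ∈-upTo⁺; ∈-map⁺; ∈-++⁺ˡ; ∈-++⁺ʳ; ∈-++⁻; ∈-filter⁺; ∈-filter⁻; ∈-concatMap⁺; ∈-concatMap⁻; ∈-cartesianProductWith⁺; ∈-cartesianProduct⁺)
import Data.List.Membership.DecPropositional as DecMembership
open import Data.List.Relation.Unary.Any using (Any; here; there; _─_; index)
import Data.List.Relation.Unary.Any as Any
import Data.List.Relation.Unary.Any.Properties as Any
open import Data.List.Relation.Unary.All using (All; []; _∷_)
import Data.List.Relation.Unary.All as All
import Data.List.Relation.Unary.All.Properties as All
open import Data.List.Relation.Unary.AllPairs using (AllPairs; []; _∷_)
import Data.List.Relation.Unary.AllPairs as AllPairs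
import Data.List.Relation.Unary.AllPairs.Properties as AllPairs
import Data.List.Relation.Unary.Unique.Propositional.Properties as Unique
open import Data.Product using (Σ; ∃; _×_; _,_; proj₁; proj₂)
open import Data.Product.Properties using (≡-dec)
open import Data.Sum using (_⊎_; inj₁; inj₂)
open import Data.Empty using (⊥; ⊥-elim)
open import Relation.Nullary using (¬_; Dec; does; yes; no; contradiction)
open import Relation.Nullary.Decidable using (¬?; _×-dec_; decidable-stable; dec-true; dec-false; ¬¬-excluded-middle)
open import Relation.Binary.PropositionalEquality using (_≡_; _≢_; refl; sym; trans; cong; cong₂; subst; subst₂; ≢-sym)
open import Function using (_∘_; id)
open import Function.Bundles using (_↔_; Inverse; Equivalence; mk↔ₛ′)
open import Function.Properties.Inverse using (↔-refl; ↔-sym; ↔-trans)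
open import Algebra.Properties.CommutativeMonoid.Sum +-0-commutativeMonoid using (sum; sum-cong-≗; ∑-distrib-+; ∑-comm; sum-permute)
open Inverse using (to; from; strictlyInverseˡ; strictlyInverseʳ)

-- The factor 1/4 comes from allowing three new classes per pebble and no more: next to its own
-- class a vertex can then split only two others, so the matched part of a component of Γ has at
-- most two ends. The obstacle is that an isomorphism is far too large for the board. A growing
-- matching is therefore kept off the board; only the classes at its two ends and the next class are
-- pebbled, and adjacency between other classes is dictated by majorities. Majorities and Γ are
-- defined on `G` alone. Facts about `H` are obtained by answering a vertex of `H` with one of `G`,
-- which is why positions on `(G , G)`, giving the classes, and positions on `(G , H)`, giving the
-- transfer, are taken from the same round of the refinement and can be composed. The value of `d`
-- is a compromise: the separating set has about `(n / d) * log n` elements, which asks for a large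
-- `d`, whereas a class may fill a ball of size `(1 + 2 * d) ^ 6` that has to fit on the board.

side : ColoredGraph → ColoredGraph → Bool → ColoredGraph
side G H true  = G
side G H false = H

diag : {A : Set} → List A → List (A × A)
diag = map (λ x → x , x)

map-proj₁-diag : {A : Set} (s : List A) → map proj₁ (diag s) ≡ s
map-proj₁-diag []      = refl
map-proj₁-diag (x ∷ s) = cong (x ∷_) (map-proj₁-diag s)

map-proj₂-diag : {A : Set} (s : List A) → map proj₂ (diag s) ≡ s
map-proj₂-diag []      = refl
map-proj₂-diag (x ∷ s) = cong (x ∷_) (map-proj₂-diag s)

-- Good b p: pebbling the pairs of p is a winning position for Duplicator
-- on (G, side G H b), where at most K pairs are ever on the board.
record GameEquivalence (G H : ColoredGraph) (K : ℕ) : Set₁ where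
  V : Set
  V = Fin (n G)

  W : Bool → Set
  W b = Fin (n (side G H b))

  field
    Good      : ∀ b → List (V × W b) → Set
    good?     : ∀ b p → Dec (Good b p)
    good-[]   : ∀ b → Good b []
    good-⊆    : ∀ {b p q} → length p ≤ K → length q ≤ K →
                (∀ {e} → e ∈ p → e ∈ q) → Good b q → Good b p
    good-ext  : ∀ {b p} → length p < K → Good b p →
                Σ (V ↔ W b) λ f → ∀ x → Good b ((x , to f x) ∷ p)
    good-fun  : ∀ {b p} → length p ≤ K → Good b p → ∀ {x y y′} →
                (x , y) ∈ p → (x , y′) ∈ p → y ≡ y′
    good-inj  : ∀ {b p} → length p ≤ K → Good b p → ∀ {x x′ y} →
                (x , y) ∈ p → (x′ , y) ∈ p → x ≡ x′
    good-adj  : ∀ {b p} → length p ≤ K → Good b p → ∀ {x y x′ y′} →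
                (x , y) ∈ p → (x′ , y′) ∈ p → adj G x x′ ≡ adj (side G H b) y y′
    good-col  : ∀ {b p} → length p ≤ K → Good b p → ∀ {x y} →
                (x , y) ∈ p → col G x ≡ col (side G H b) y
    good-refl : ∀ s → Good true (diag s)
    good-trans : ∀ {b p x x′ y} → Good true ((x , x′) ∷ diag (map proj₁ p)) →
                Good b ((x′ , y) ∷ p) → Good b ((x , y) ∷ p)
    good-join : ∀ {b p x x′ y} → Good b ((x , y) ∷ p) → Good b ((x′ , y) ∷ p) →
                Good true ((x , x′) ∷ diag (map proj₁ p))

-- Colour equality of tuples under refinement.

module Refinement (K : ℕ) where

  k : ℕ
  k = suc (suc K)

  sameCol-refl : ∀ r A v → SameCol k r A A v v
  sameCol-refl zero    A v = (λ i j → id , id) , (λ i j → refl) , (λ i → refl)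
  sameCol-refl (suc r) A v =
    sameCol-refl r A v , ↔-refl , λ x i → sameCol-refl r A (v [ i ]≔ x)

  sameCol-sym : ∀ r A B {v w} → SameCol k r A B v w → SameCol k r B A w v
  sameCol-sym zero A B (e , a , c) =
    (λ i j → proj₂ (e i j) , proj₁ (e i j)) , (λ i j → sym (a i j)) , (λ i → sym (c i))
  sameCol-sym (suc r) A B {v} {w} (p , f , h) =
    sameCol-sym r A B p , ↔-sym f , λ y i → sameCol-sym r A B
      (subst (λ z → SameCol k r A B (v [ i ]≔ from f y) (w [ i ]≔ z)) (strictlyInverseˡ f y) (h (from f y) i))

  sameCol-trans : ∀ r A B C {u v w} → SameCol k r A B u v → SameCol k r B C v w → SameCol k r A C u w
  sameCol-trans zero A B C (e , a , c) (e′ , a′ , c′) =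
    (λ i j → proj₁ (e′ i j) ∘ proj₁ (e i j) , proj₂ (e i j) ∘ proj₂ (e′ i j)) ,
    (λ i j → trans (a i j) (a′ i j)) , (λ i → trans (c i) (c′ i))
  sameCol-trans (suc r) A B C (p , f , h) (p′ , f′ , h′) =
    sameCol-trans r A B C p p′ , ↔-trans f f′ , λ x i → sameCol-trans r A B C (h x i) (h′ (to f x) i)

  sameCol-atp : ∀ r A B {v w} → SameCol k r A B v w → SameAtp k A B v w
  sameCol-atp zero    A B s = s
  sameCol-atp (suc r) A B s = sameCol-atp r A B (proj₁ s)

  sameCol-antitone : ∀ {r r′} A B {v w} → r ≤ r′ → SameCol k r′ A B v w → SameCol k r A B v w
  sameCol-antitone {r} {r′} A B r≤ s = go (≤⇒≤′ r≤) s where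
    go : ∀ {r′} → r ℕ.≤′ r′ → SameCol k r′ A B _ _ → SameCol k r A B _ _
    go (ℕ.≤′-reflexive refl) s = s
    go (ℕ.≤′-step r≤′)       s = go r≤′ (proj₁ s)

  -- Without `i` only `m` positions remain to cover `suc m` values. If every value had a preimage
  -- other than `i`, choosing one for each value would inject `Fin (suc m)` into `Fin m`.
  unused-index : ∀ {m} (σ : Fin (suc m) → Fin (suc m)) i → ∃ λ l → ∀ j → j ≢ i → σ j ≢ l
  unused-index {m} σ i with any? (λ l → ¬? (any? (λ j → ¬? (j ≟ᶠ i) ×-dec (σ j ≟ᶠ l))))
  ... | yes (l , h) = l , λ j j≢i σj≡l → h (j , j≢i , σj≡l)
  ... | no  h = ⊥-elim (clash (pigeonhole (n<1+n m) (λ l → punchOut (i≢pre l))))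
    where
    pre : ∀ l → ∃ λ j → j ≢ i × σ j ≡ l
    pre l = decidable-stable (any? (λ j → ¬? (j ≟ᶠ i) ×-dec (σ j ≟ᶠ l))) (λ ¬p → h (l , ¬p))
    i≢pre : ∀ l → i ≢ proj₁ (pre l)
    i≢pre l = proj₁ (proj₂ (pre l)) ∘ sym
    clash : (∃ λ l → ∃ λ l′ → (l Data.Fin.< l′) × punchOut (i≢pre l) ≡ punchOut (i≢pre l′)) → ⊥
    clash (l , l′ , l<l′ , eq) = <ᶠ⇒≢ l<l′ (trans (sym (proj₂ (proj₂ (pre l))))
      (trans (cong σ (punchOut-injective (i≢pre l) (i≢pre l′) eq)) (proj₂ (proj₂ (pre l′)))))

  -- One index `j` serves both sides, so permuting, repeating and dropping pebbled pairs are all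
  -- instances of this relation.
  Sub : ∀ {A B : Set} → (v′ v : Vec A k) → (w′ w : Vec B k) → Set
  Sub v′ v w′ w = ∀ i → ∃ λ j → lookup v′ i ≡ lookup v j × lookup w′ i ≡ lookup w j

  -- Among the k positions of v, one is not needed for the positions of v′ other than i;
  -- updating v there simulates the update of v′ at i.
  sameCol-sub : ∀ r A B {v′ v w′ w} → Sub v′ v w′ w → SameCol k r A B v w → SameCol k r A B v′ w′
  sameCol-sub zero A B {v′} {v} {w′} {w} sub (e , a , c) =
    (λ i j → (λ eq → trans (w≡ i) (trans (proj₁ (e (σ i) (σ j)) (trans (sym (v≡ i)) (trans eq (v≡ j)))) (sym (w≡ j)))) ,
             (λ eq → trans (v≡ i) (trans (proj₂ (e (σ i) (σ j)) (trans (sym (w≡ i)) (trans eq (w≡ j)))) (sym (v≡ j))))) ,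
    (λ i j → trans (cong₂ (adj A) (v≡ i) (v≡ j)) (trans (a (σ i) (σ j)) (sym (cong₂ (adj B) (w≡ i) (w≡ j))))) ,
    (λ i → trans (cong (col A) (v≡ i)) (trans (c (σ i)) (sym (cong (col B) (w≡ i)))))
    where
    σ : Fin k → Fin k
    σ i = proj₁ (sub i)
    v≡ : ∀ i → lookup v′ i ≡ lookup v (σ i)
    v≡ i = proj₁ (proj₂ (sub i))
    w≡ : ∀ i → lookup w′ i ≡ lookup w (σ i)
    w≡ i = proj₂ (proj₂ (sub i))
  sameCol-sub (suc r) A B {v′} {v} {w′} {w} sub (p , f , h) =
    sameCol-sub r A B sub p , f , λ x i → step x i (unused-index (λ j → proj₁ (sub j)) i)
    where
    step : ∀ x i → (∃ λ l → ∀ j → j ≢ i → proj₁ (sub j) ≢ l) →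
           SameCol k r A B (v′ [ i ]≔ x) (w′ [ i ]≔ to f x)
    step x i (l , free) = sameCol-sub r A B sub′ (h x l)
      where
      sub′ : Sub (v′ [ i ]≔ x) (v [ l ]≔ x) (w′ [ i ]≔ to f x) (w [ l ]≔ to f x)
      sub′ j with j ≟ᶠ i
      ... | yes refl = l , trans (lookup∘update i v′ x) (sym (lookup∘update l v x)) ,
                           trans (lookup∘update i w′ _) (sym (lookup∘update l w _))
      ... | no j≢i = proj₁ (sub j) ,
        trans (lookup∘update′ j≢i v′ x) (trans (proj₁ (proj₂ (sub j))) (sym (lookup∘update′ (free j j≢i) v x))) ,
        trans (lookup∘update′ j≢i w′ _) (trans (proj₂ (proj₂ (sub j))) (sym (lookup∘update′ (free j j≢i) w _)))

-- Padding of positions to tuples, and stabilisation of finitely many colours.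

pad : ∀ {A : Set} m → A → List A → Vec A m
pad zero    d l       = []
pad (suc m) d []      = d ∷ pad m d []
pad (suc m) d (x ∷ l) = x ∷ pad m d l

module _ {A B : Set} {a₀ : A} {b₀ : B} where

  pad-split : ∀ m (p : List (A × B)) i →
    (lookup (pad m a₀ (map proj₁ p)) i , lookup (pad m b₀ (map proj₂ p)) i) ∈ p ⊎
    (lookup (pad m a₀ (map proj₁ p)) i ≡ a₀ × lookup (pad m b₀ (map proj₂ p)) i ≡ b₀)
  pad-split (suc m) []      fz     = inj₂ (refl , refl)
  pad-split (suc m) []      (fs i) = pad-split m [] i
  pad-split (suc m) (e ∷ p) fz     = inj₁ (here refl)
  pad-split (suc m) (e ∷ p) (fs i) with pad-split m p i
  ... | inj₁ e∈p = inj₁ (there e∈p)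
  ... | inj₂ eqs = inj₂ eqs

  pad-index : ∀ m (p : List (A × B)) {x y} → length p ≤ m → (x , y) ∈ p →
    ∃ λ i → toℕ i < length p × x ≡ lookup (pad m a₀ (map proj₁ p)) i × y ≡ lookup (pad m b₀ (map proj₂ p)) i
  pad-index (suc m) (e ∷ p) (s≤s len) (here refl) = fz , s≤s z≤n , refl , refl
  pad-index (suc m) (e ∷ p) (s≤s len) (there e∈p) =
    let i , i< , eqs = pad-index m p len e∈p in fs i , s≤s i< , eqs

  pad-default : ∀ m (p : List (A × B)) → length p < m →
    ∃ λ i → toℕ i ≡ length p × a₀ ≡ lookup (pad m a₀ (map proj₁ p)) i × b₀ ≡ lookup (pad m b₀ (map proj₂ p)) i
  pad-default (suc m) []      len       = fz , refl , refl , refl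
  pad-default (suc m) (e ∷ p) (s≤s len) =
    let i , i≡ , eqs = pad-default m p len in fs i , cong suc i≡ , eqs

allVec : ∀ m k → List (Vec (Fin m) k)
allVec m zero    = [] ∷ []
allVec m (suc k) = cartesianProductWith _∷_ (allFin m) (allVec m k)

∈-allVec : ∀ {m k} (v : Vec (Fin m) k) → v ∈ allVec m k
∈-allVec []      = here refl
∈-allVec (x ∷ v) = ∈-cartesianProductWith⁺ _∷_ (∈-allFin x) (∈-allVec v)

-- Double negation commutes with a conjunction over a list; over an infinite domain this would be
-- double negation shift. Hence all tuples and all relevant rounds are listed.
¬¬-all : ∀ {A : Set} {P : A → Set} (l : List A) → (∀ x → ¬ ¬ P x) → ¬ ¬ (∀ {x} → x ∈ l → P x)
¬¬-all []      h q = q λ ()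
¬¬-all (x ∷ l) h q = h x λ px → ¬¬-all l h λ ps → q λ { (here refl) → px ; (there x∈) → ps x∈ }

∈-remove : ∀ {A : Set} {x y : A} {l} (x∈l : x ∈ l) → y ∈ l → y ≡ x ⊎ y ∈ (l ─ x∈l)
∈-remove (here refl) (here eq)   = inj₁ eq
∈-remove (here refl) (there y∈)  = inj₂ y∈
∈-remove {l = _ ∷ _ ∷ _} (there x∈) (here eq)  = inj₂ (here eq)
∈-remove {l = _ ∷ _ ∷ _} (there x∈) (there y∈) with ∈-remove x∈ y∈
... | inj₁ eq = inj₁ eq
... | inj₂ y∈′ = inj₂ (there y∈′)

remove-⊆ : ∀ {A : Set} {x y : A} {l} (x∈l : x ∈ l) → y ∈ (l ─ x∈l) → y ∈ l
remove-⊆ {l = _ ∷ _} (here _) y∈ = there y∈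
remove-⊆ {l = _ ∷ _ ∷ _} (there x∈) (here eq) = here eq
remove-⊆ {l = _ ∷ _ ∷ _} (there x∈) (there y∈) = there (remove-⊆ x∈ y∈)

find-∈ : ∀ {A : Set} {P : A → Set} (l : List A) → (∀ {x} → x ∈ l → Dec (P x)) →
         (∃ λ x → x ∈ l × P x) ⊎ (∀ {x} → x ∈ l → ¬ P x)
find-∈ [] P? = inj₂ λ ()
find-∈ (x ∷ l) P? with P? (here refl)
... | yes px = inj₁ (x , here refl , px)
... | no ¬px with find-∈ l (P? ∘ there)
...   | inj₁ (y , y∈ , py) = inj₁ (y , there y∈ , py)
...   | inj₂ none = inj₂ λ { (here refl) → ¬px ; (there x∈) → none x∈ }

-- A round that is not stable loses an element of `l`, by antitonicity for good, so at most
-- `length l` rounds can fail. Decidability is asked for up to round `suc (s + m)` only: these are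
-- finitely many instances, which can be assumed under a double negation.
antitone-stabilises : ∀ {A : Set} (P : ℕ → A → Set) → (∀ {r r′ x} → r ≤ r′ → P r′ x → P r x) →
  ∀ m (l : List A) s → length l ≤ m → (∀ {r x} → r ≤ suc (s ℕ.+ m) → x ∈ l → Dec (P r x)) →
  ∃ λ r → s ≤ r × r ≤ s ℕ.+ m × (∀ {x} → x ∈ l → P r x → P (suc r) x)
antitone-stabilises P anti m l s len P? with find-∈ {P = λ x → P s x × ¬ P (suc s) x} l
    (λ x∈ → P? (m≤n⇒m≤1+n (m≤m+n s m)) x∈ ×-dec ¬? (P? (s≤s (m≤m+n s m)) x∈))
... | inj₂ none = s , ≤-refl , m≤m+n s m , λ x∈ px →
        decidable-stable (P? (s≤s (m≤m+n s m)) x∈) (λ ¬px → none x∈ (px , ¬px))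
antitone-stabilises P anti zero (_ ∷ _) s () P? | inj₁ _
antitone-stabilises P anti (suc m) l s len P? | inj₁ (x , x∈ , px , ¬px)
  with antitone-stabilises P anti m (l ─ x∈) (suc s)
         (≤-pred (≤-trans (≤-reflexive (sym (length-removeAt′ l (index x∈)))) len))
         (λ r≤ y∈ → P? (≤-trans r≤ (≤-reflexive (cong suc (sym (+-suc s m))))) (remove-⊆ x∈ y∈))
... | r , s<r , r≤ , stable = r , <⇒≤ s<r , ≤-trans r≤ (≤-reflexive (sym (+-suc s m))) ,
      λ y∈ py → go y∈ py (∈-remove x∈ y∈)
  where
  go : ∀ {y} → y ∈ l → P r y → y ≡ x ⊎ y ∈ (l ─ x∈) → P (suc r) y
  go y∈ py (inj₁ refl) = contradiction (anti s<r py) ¬px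
  go y∈ py (inj₂ y∈′)  = stable y∈′ py

tuplePairs : ∀ k (G H : ColoredGraph) → List (Tuple k G × Tuple k H)
tuplePairs k G H = cartesianProduct (allVec (n G) k) (allVec (n H) k)

-- Every round that changes the partition separates a new pair of tuples.
stableRound : ℕ → ColoredGraph → ColoredGraph → ℕ
stableRound k G H = suc (length (tuplePairs k G H))

-- Winning positions of Duplicator from a stable colouring.

module _ (K : ℕ) (G H : ColoredGraph) where

  open Refinement K

  private
    root : Fin (n G)
    root = fromℕ< (nonEmpty G)

  module Stable
    (sameMultiset : SameMultiset k (stableRound k G H) G H)
    (r : ℕ) (r<R : r < stableRound k G H)
    (stable : ∀ {v w} → SameCol k r G H v w → SameCol k (suc r) G H v w)
    (dec-GH : ∀ v w → Dec (SameCol k r G H v w))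
    (dec-GG : ∀ v w → Dec (SameCol k r G G v w)) where

    private
      partner : ∀ v → ∃ λ w → SameCol k (suc r) G H v w
      partner v = _ , sameCol-antitone G H r<R (proj₂ sameMultiset v)

      -- Provides the padding vertex for `H`. Reading the same entry of the partner of a constant
      -- tuple everywhere gives a constant tuple again, so that padding adds one fixed pair to every
      -- position.
      root-partner : ∃ λ y → SameCol k (suc r) G H (replicate k root) (replicate k y)
      root-partner = let w , s = partner (replicate k root) in
        lookup w fz , sameCol-sub (suc r) G H (sub w s) s
        where
        sub : ∀ w → SameCol k (suc r) G H (replicate k root) w →
              Sub (replicate k root) (replicate k root) (replicate k (lookup w fz)) w
        sub w s i = fz , lookup-replicate i root , lookup-replicate i _

      rootOf : ∀ b → Fin (n (side G H b))
      rootOf true  = root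
      rootOf false = proj₁ root-partner

      SC : ∀ b → Tuple k G → Tuple k (side G H b) → Set
      SC b = SameCol k r G (side G H b)

      -- Stability is given for pairs in `(G , H)`. For `v` and `v′` in `G` it is borrowed from a
      -- partner `w` of `v` in `H`: both have the colour of `w` after round `r`, hence also after
      -- round `suc r`.
      SC-step : ∀ b {v w} → SC b v w → SameCol k (suc r) G (side G H b) v w
      SC-step false s = stable s
      SC-step true {v} {v′} s = let w , s′ = partner v in
        sameCol-trans (suc r) G H G s′
          (sameCol-sym (suc r) G H (stable (sameCol-trans r G G H (sameCol-sym r G G s) (proj₁ s′))))

      SC? : ∀ b v w → Dec (SC b v w)
      SC? true  = dec-GG
      SC? false = dec-GH

      -- With at most `K` pairs on the board, two of the `k` positions stay free. One keeps the
      -- padding pair, to which `good-⊆` refers; the last one is overwritten in `good-ext`.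
      Good : ∀ b → List (Fin (n G) × Fin (n (side G H b))) → Set
      Good b p = SC b (pad k root (map proj₁ p)) (pad k (rootOf b) (map proj₂ p))

      pad-[] : ∀ {A : Set} m (d : A) → pad m d [] ≡ replicate m d
      pad-[] zero    d = refl
      pad-[] (suc m) d = cong (d ∷_) (pad-[] m d)

      good-[] : ∀ b → Good b []
      good-[] true  = sameCol-refl r G _
      good-[] false = subst₂ (SC false) (sym (pad-[] k root)) (sym (pad-[] k _)) (proj₁ (proj₂ root-partner))

      ≤k : ∀ {m} → m ≤ K → m ≤ k
      ≤k = m≤n⇒m≤1+n ∘ m≤n⇒m≤1+n

      good-⊆ : ∀ {b p q} → length p ≤ K → length q ≤ K →
               (∀ {e} → e ∈ p → e ∈ q) → Good b q → Good b p
      good-⊆ {b} {p} {q} lp lq p⊆q = sameCol-sub r G (side G H b) sub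
        where
        sub : Sub (pad k root (map proj₁ p)) (pad k root (map proj₁ q))
                  (pad k (rootOf b) (map proj₂ p)) (pad k (rootOf b) (map proj₂ q))
        sub i with pad-split k p i
        ... | inj₁ e∈p = let j , _ , eqs = pad-index k q (≤k lq) (p⊆q e∈p) in j , eqs
        ... | inj₂ (eq₁ , eq₂) = let j , _ , eq₁′ , eq₂′ = pad-default k q (s≤s (m≤n⇒m≤1+n lq)) in
                j , trans eq₁ eq₁′ , trans eq₂ eq₂′

      good-ext : ∀ {b p} → length p < K → Good b p →
                 Σ (Fin (n G) ↔ Fin (n (side G H b))) λ f → ∀ x → Good b ((x , to f x) ∷ p)
      good-ext {b} {p} lp gp = let _ , f , h = SC-step b gp in
        f , λ x → sameCol-sub r G (side G H b) (sub x (to f x)) (h x last)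
        where
        last : Fin k
        last = fromℕ (suc K)
        vG : Tuple k G
        vG = pad k root (map proj₁ p)
        vB : Tuple k (side G H b)
        vB = pad k (rootOf b) (map proj₂ p)
        toℕ-last : suc K ≡ toℕ last
        toℕ-last = sym (toℕ-fromℕ (suc K))
        ≢last : ∀ {i : Fin k} → toℕ i ≤ length p → i ≢ last
        ≢last i≤ refl = <⇒≱ (≤-trans lp (m≤n⇒m≤1+n ≤-refl)) (≤-trans (≤-reflexive toℕ-last) i≤)
        sub : ∀ x y → Sub (pad k root (x ∷ map proj₁ p)) (vG [ last ]≔ x)
                          (pad k (rootOf b) (y ∷ map proj₂ p)) (vB [ last ]≔ y)
        sub x y i with pad-split k ((x , y) ∷ p) i
        ... | inj₁ (here eq) = last , trans (cong proj₁ eq) (sym (lookup∘update last vG x)) ,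
                                      trans (cong proj₂ eq) (sym (lookup∘update last vB y))
        ... | inj₁ (there e∈) = let j , j< , eq₁ , eq₂ = pad-index k p (≤k (<⇒≤ lp)) e∈
                                    j≢ = ≢last (<⇒≤ j<) in
                j , trans eq₁ (sym (lookup∘update′ j≢ vG x)) , trans eq₂ (sym (lookup∘update′ j≢ vB y))
        ... | inj₂ (eq₁ , eq₂) = let j , j≡ , eq₁′ , eq₂′ = pad-default k p (≤k lp)
                                     j≢ = ≢last (≤-reflexive j≡) in
                j , trans eq₁ (trans eq₁′ (sym (lookup∘update′ j≢ vG x))) ,
                    trans eq₂ (trans eq₂′ (sym (lookup∘update′ j≢ vB y)))

      good-trans : ∀ {b p x x′ y} → Good true ((x , x′) ∷ diag (map proj₁ p)) →
                   Good b ((x′ , y) ∷ p) → Good b ((x , y) ∷ p)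
      good-trans {b} {p} {x} {x′} g g′ = sameCol-trans r G G (side G H b)
        (subst₂ (λ l l′ → SC true (pad k root (x ∷ l)) (pad k root (x′ ∷ l′)))
          (map-proj₁-diag (map proj₁ p)) (map-proj₂-diag (map proj₁ p)) g) g′

      good-join : ∀ {b p x x′ y} → Good b ((x , y) ∷ p) → Good b ((x′ , y) ∷ p) →
                  Good true ((x , x′) ∷ diag (map proj₁ p))
      good-join {b} {p} {x} {x′} g g′ =
        subst₂ (λ l l′ → SC true (pad k root (x ∷ l)) (pad k root (x′ ∷ l′)))
          (sym (map-proj₁-diag (map proj₁ p))) (sym (map-proj₂-diag (map proj₁ p)))
          (sameCol-trans r G (side G H b) G g (sameCol-sym r G (side G H b) g′))

      good-refl : ∀ s → Good true (diag s)
      good-refl s = subst₂ (λ l l′ → SC true (pad k root l) (pad k root l′))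
        (sym (map-proj₁-diag s)) (sym (map-proj₂-diag s)) (sameCol-refl r G _)

      good-fun : ∀ {b p} → length p ≤ K → Good b p → ∀ {x y y′} →
                 (x , y) ∈ p → (x , y′) ∈ p → y ≡ y′
      good-fun {b} {p} lp g m m′ =
        let i , _ , eq₁ , eq₂ = pad-index k p (≤k lp) m
            j , _ , eq₁′ , eq₂′ = pad-index k p (≤k lp) m′
        in trans eq₂ (trans (proj₁ (proj₁ (sameCol-atp r G (side G H b) g) i j) (trans (sym eq₁) eq₁′)) (sym eq₂′))

      good-inj : ∀ {b p} → length p ≤ K → Good b p → ∀ {x x′ y} →
                 (x , y) ∈ p → (x′ , y) ∈ p → x ≡ x′
      good-inj {b} {p} lp g m m′ =
        let i , _ , eq₁ , eq₂ = pad-index k p (≤k lp) m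
            j , _ , eq₁′ , eq₂′ = pad-index k p (≤k lp) m′
        in trans eq₁ (trans (proj₂ (proj₁ (sameCol-atp r G (side G H b) g) i j) (trans (sym eq₂) eq₂′)) (sym eq₁′))

      good-adj : ∀ {b p} → length p ≤ K → Good b p → ∀ {x y x′ y′} →
                 (x , y) ∈ p → (x′ , y′) ∈ p → adj G x x′ ≡ adj (side G H b) y y′
      good-adj {b} {p} lp g m m′ =
        let i , _ , eq₁ , eq₂ = pad-index k p (≤k lp) m
            j , _ , eq₁′ , eq₂′ = pad-index k p (≤k lp) m′
        in trans (cong₂ (adj G) eq₁ eq₁′) (trans (proj₁ (proj₂ (sameCol-atp r G (side G H b) g)) i j)
             (sym (cong₂ (adj (side G H b)) eq₂ eq₂′)))

      good-col : ∀ {b p} → length p ≤ K → Good b p → ∀ {x y} →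
                 (x , y) ∈ p → col G x ≡ col (side G H b) y
      good-col {b} {p} lp g m =
        let i , _ , eq₁ , eq₂ = pad-index k p (≤k lp) m
        in trans (cong (col G) eq₁) (trans (proj₂ (proj₂ (sameCol-atp r G (side G H b) g)) i)
             (sym (cong (col (side G H b)) eq₂)))

    gameEquivalence : GameEquivalence G H K
    gameEquivalence = record
      { Good = Good ; good? = λ b p → SC? b _ _ ; good-[] = good-[]
      ; good-⊆ = λ {b} → good-⊆ {b} ; good-ext = λ {b} → good-ext {b}
      ; good-fun = λ {b} → good-fun {b} ; good-inj = λ {b} → good-inj {b}
      ; good-adj = λ {b} → good-adj {b} ; good-col = λ {b} → good-col {b}
      ; good-refl = good-refl
      ; good-trans = λ {b} {p} → good-trans {b} {p} ; good-join = λ {b} {p} → good-join {b} {p} }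

  -- Equality of colours is not decided constructively here, but an absurdity is
  -- to be derived, so it may be assumed decidable for the finitely many tuples.
  ¬¬-gameEquivalence : SameMultiset k (stableRound k G H) G H → ¬ ¬ GameEquivalence G H K
  ¬¬-gameEquivalence sm ¬ge =
    ¬¬-all (upTo (suc (suc (length pairs)))) (λ r → ¬¬-all pairs (λ e → ¬¬-excluded-middle)) λ dec →
    ¬¬-all pairsGG (λ e → ¬¬-all (upTo (suc (suc (length pairs)))) (λ r → ¬¬-excluded-middle)) λ decGG →
    ¬ge (build (λ {r} r≤ → dec {r} (∈-upTo⁺ (s≤s r≤))) (λ {r} r≤ e∈ → decGG e∈ {r} (∈-upTo⁺ (s≤s r≤))))
    where
    pairs : List (Tuple k G × Tuple k H)
    pairs = tuplePairs k G H
    pairsGG : List (Tuple k G × Tuple k G)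
    pairsGG = tuplePairs k G G
    build : (∀ {r} → r ≤ suc (length pairs) → ∀ {e} → e ∈ pairs → Dec (SameCol k r G H (proj₁ e) (proj₂ e))) →
            (∀ {r} → r ≤ suc (length pairs) → ∀ {e} → e ∈ pairsGG → Dec (SameCol k r G G (proj₁ e) (proj₂ e))) →
            GameEquivalence G H K
    build dec decGG =
      let r , _ , r≤ , stable = antitone-stabilises (λ r e → SameCol k r G H (proj₁ e) (proj₂ e))
                                  (sameCol-antitone G H) (length pairs) pairs 0 ≤-refl (λ r≤ → dec r≤)
      in Stable.gameEquivalence sm r (s≤s r≤)
           (λ {v} {w} → stable (∈-cartesianProduct⁺ (∈-allVec v) (∈-allVec w)))
           (λ v w → dec (m≤n⇒m≤1+n r≤) (∈-cartesianProduct⁺ (∈-allVec v) (∈-allVec w)))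
           (λ v w → decGG (m≤n⇒m≤1+n r≤) (∈-cartesianProduct⁺ (∈-allVec v) (∈-allVec w)))

-- Hitting sets and separation of vertices with different neighbourhoods.

module Counting where

  open import Data.Nat using (_+_; _*_; _^_)

  𝟙 : Bool → ℕ
  𝟙 true  = 1
  𝟙 false = 0

  # : ∀ {m} → (Fin m → Bool) → ℕ
  # P = sum (𝟙 ∘ P)

  sum-mono : ∀ {m} {f g : Fin m → ℕ} → (∀ i → f i ≤ g i) → sum f ≤ sum g
  sum-mono {zero}  h = z≤n
  sum-mono {suc m} h = +-mono-≤ (h fz) (sum-mono (h ∘ fs))

  sum-*ˡ : ∀ {m} c (f : Fin m → ℕ) → sum (λ i → c * f i) ≡ c * sum f
  sum-*ˡ {zero}  c f = sym (*-zeroʳ c)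
  sum-*ˡ {suc m} c f = trans (cong (c * f fz +_) (sum-*ˡ c (f ∘ fs))) (sym (*-distribˡ-+ c (f fz) _))

  average : ∀ {m} (f : Fin (suc m) → ℕ) → ∃ λ i → sum f ≤ suc m * f i
  average {zero} f = fz , ≤-refl
  average {suc m} f with average (f ∘ fs)
  ... | i , le with ≤-total (f fz) (f (fs i))
  ...   | inj₁ f₀≤ = fs i , +-mono-≤ f₀≤ le
  ...   | inj₂ ≤f₀ = fz , +-monoʳ-≤ (f fz) (≤-trans le (*-monoʳ-≤ (suc m) ≤f₀))

  module _ {X : Set} where

    count : (X → Bool) → List X → ℕ
    count P []      = 0
    count P (x ∷ l) = 𝟙 (P x) + count P l

    count-split : ∀ (P : X → Bool) (l : List X) → length (filterᵇ (not ∘ P) l) + count P l ≡ length l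
    count-split P [] = refl
    count-split P (x ∷ l) with P x
    ... | true  = trans (+-suc _ _) (cong suc (count-split P l))
    ... | false = cong suc (count-split P l)

    ∈-filterᵇ-split : ∀ (P : X → Bool) (l : List X) {x} → x ∈ l → P x ≡ true ⊎ x ∈ filterᵇ (not ∘ P) l
    ∈-filterᵇ-split P (y ∷ l) (here refl) with P y
    ... | true  = inj₁ refl
    ... | false = inj₂ (here refl)
    ∈-filterᵇ-split P (y ∷ l) (there x∈) with ∈-filterᵇ-split P l x∈
    ... | inj₁ px = inj₁ px
    ... | inj₂ x∈′ with P y
    ...   | true  = inj₂ x∈′
    ...   | false = inj₂ (there x∈′)

    filterᵇ-⊆ : ∀ (P : X → Bool) (l : List X) {x} → x ∈ filterᵇ P l → x ∈ l
    filterᵇ-⊆ P (y ∷ l) x∈ with P y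
    filterᵇ-⊆ P (y ∷ l) (here eq)  | true  = here eq
    filterᵇ-⊆ P (y ∷ l) (there x∈) | true  = there (filterᵇ-⊆ P l x∈)
    filterᵇ-⊆ P (y ∷ l) x∈         | false = there (filterᵇ-⊆ P l x∈)

  -- Greedy hitting set: an average vertex hits a fraction d/n₀ of the remaining
  -- elements, so ⌈n₀/d⌉ choices halve their number.
  module _ {X : Set} {m : ℕ} (hits : Fin (suc m) → X → Bool) (d : ℕ) where

    private
      n₀ : ℕ
      n₀ = suc m

      Rich : List X → Set
      Rich l = ∀ {e} → e ∈ l → d ≤ # (λ z → hits z e)

      Hit : List (Fin n₀) → X → Set
      Hit t e = ∃ λ z → z ∈ t × hits z e ≡ true

    double-count : ∀ l → Rich l → d * length l ≤ sum (λ z → count (hits z) l)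
    double-count []      rich = ≤-trans (≤-reflexive (*-zeroʳ d)) z≤n
    double-count (e ∷ l) rich = begin
      d * suc (length l)                                     ≡⟨ *-suc d (length l) ⟩
      d + d * length l                                       ≤⟨ +-mono-≤ (rich (here refl)) (double-count l (rich ∘ there)) ⟩
      # (λ z → hits z e) + sum (λ z → count (hits z) l)      ≡⟨ sym (∑-distrib-+ (λ z → 𝟙 (hits z e)) (λ z → count (hits z) l)) ⟩
      sum (λ z → count (hits z) (e ∷ l))                     ∎
      where open ≤-Reasoning

    -- While more than half of `l` remains, an average vertex hits at least
    -- `d * length l / (2 * n₀)` of the remaining elements, so the loss is linear in the number `j`
    -- of choices. The second alternative is this bound with denominators cleared.
    halving : ∀ l → Rich l → ∀ j → ∃ λ t → length t ≤ j × ∃ λ r →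
      (∀ {e} → e ∈ l → Hit t e ⊎ e ∈ r) × (∀ {e} → e ∈ r → e ∈ l) ×
      (2 * length r ≤ length l ⊎ 2 * (n₀ * length r) + j * (d * length l) ≤ 2 * (n₀ * length l))
    halving l rich zero = [] , z≤n , l , inj₂ , (λ e∈ → e∈) , inj₂ (≤-reflexive (+-identityʳ _))
    halving l rich (suc j) with halving l rich j
    ... | t , t≤ , r , cov , sub , inj₁ small = t , m≤n⇒m≤1+n t≤ , r , cov , sub , inj₁ small
    ... | t , t≤ , r , cov , sub , inj₂ ineq with 2 * length r ≤? length l
    ...   | yes small = t , m≤n⇒m≤1+n t≤ , r , cov , sub , inj₁ small
    ...   | no  large with average (λ z → count (hits z) r)
    ...     | z , avg = z ∷ t , s≤s t≤ , r′ , cov′ , sub ∘ filterᵇ-⊆ (not ∘ hits z) r , inj₂ ineq′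
      where
      r′ : List X
      r′ = filterᵇ (not ∘ hits z) r
      c : ℕ
      c = count (hits z) r
      cov′ : ∀ {e} → e ∈ l → Hit (z ∷ t) e ⊎ e ∈ r′
      cov′ e∈ with cov e∈
      ... | inj₁ (w , w∈ , eq) = inj₁ (w , there w∈ , eq)
      ... | inj₂ e∈r with ∈-filterᵇ-split (hits z) r e∈r
      ...   | inj₁ eq   = inj₁ (z , here refl , eq)
      ...   | inj₂ e∈r′ = inj₂ e∈r′
      open ≤-Reasoning
      gain : d * length l ≤ 2 * (n₀ * c)
      gain = begin
        d * length l        ≤⟨ *-monoʳ-≤ d (<⇒≤ (≰⇒> large)) ⟩
        d * (2 * length r)  ≡⟨ swap d (length r) ⟩
        2 * (d * length r)  ≤⟨ *-monoʳ-≤ 2 (≤-trans (double-count r (rich ∘ sub)) avg) ⟩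
        2 * (n₀ * c)         ∎
        where
        swap : ∀ a b → a * (2 * b) ≡ 2 * (a * b)
        swap = solve-∀
      rearrange : ∀ n₀ a c e f → 2 * (n₀ * a) + (e + f) + 2 * (n₀ * c) ≡ 2 * (n₀ * (a + c)) + f + e
      rearrange = solve-∀
      ineq′ : 2 * (n₀ * length r′) + suc j * (d * length l) ≤ 2 * (n₀ * length l)
      ineq′ = +-cancelʳ-≤ (d * length l) _ _ (begin
        2 * (n₀ * length r′) + suc j * (d * length l) + d * length l ≤⟨ +-monoʳ-≤ (2 * (n₀ * length r′) + suc j * (d * length l)) gain ⟩
        2 * (n₀ * length r′) + suc j * (d * length l) + 2 * (n₀ * c)  ≡⟨ rearrange n₀ (length r′) c (d * length l) (j * (d * length l)) ⟩
        2 * (n₀ * (length r′ + c)) + j * (d * length l) + d * length l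
          ≡⟨ cong (λ a → 2 * (n₀ * a) + j * (d * length l) + d * length l) (count-split (hits z) r) ⟩
        2 * (n₀ * length r) + j * (d * length l) + d * length l      ≤⟨ +-monoˡ-≤ (d * length l) ineq ⟩
        2 * (n₀ * length l) + d * length l                           ∎)

    hitting-set : ∀ q → n₀ ≤ q * d → ∀ h l → length l < 2 ^ h → Rich l →
      ∃ λ t → length t ≤ h * q × (∀ {e} → e ∈ l → Hit t e)
    hitting-set q n₀≤qd zero [] len rich = [] , z≤n , λ ()
    hitting-set q n₀≤qd zero (_ ∷ _) (s≤s ()) rich
    hitting-set q n₀≤qd (suc h) l len rich with halving l rich q
    ... | t , t≤ , r , cov , sub , size with hitting-set q n₀≤qd h r small (rich ∘ sub)
      where
      open ≤-Reasoning
      half : 2 * length r ≤ length l ⊎ 2 * (n₀ * length r) + q * (d * length l) ≤ 2 * (n₀ * length l) →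
             2 * length r ≤ length l
      half (inj₁ le) = le
      half (inj₂ le) = *-cancelˡ-≤ n₀ (+-cancelʳ-≤ (n₀ * length l) _ _ (begin
        n₀ * (2 * length r) + n₀ * length l        ≤⟨ +-monoʳ-≤ _ (*-monoˡ-≤ (length l) n₀≤qd) ⟩
        n₀ * (2 * length r) + q * d * length l    ≡⟨ cong₂ _+_ (swap n₀ (length r)) (*-assoc q d (length l)) ⟩
        2 * (n₀ * length r) + q * (d * length l)  ≤⟨ le ⟩
        2 * (n₀ * length l)                       ≡⟨ double n₀ (length l) ⟩
        n₀ * length l + n₀ * length l              ∎))
        where
        swap : ∀ a b → a * (2 * b) ≡ 2 * (a * b)
        swap = solve-∀
        double : ∀ a b → 2 * (a * b) ≡ a * b + a * b
        double = solve-∀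
      small : length r < 2 ^ h
      small = *-cancelˡ-< 2 _ _ (≤-<-trans (half size) len)
    ...   | t′ , t′≤ , cov′ = t ++ t′ , ≤-trans (≤-reflexive (length-++ t)) (+-mono-≤ t≤ t′≤) , λ e∈ → hit (cov e∈)
      where
      hit : ∀ {e} → Hit t e ⊎ e ∈ r → Hit (t ++ t′) e
      hit (inj₁ (z , z∈ , eq)) = z , ∈-++⁺ˡ z∈ , eq
      hit (inj₂ e∈) = let z , z∈ , eq = cov′ e∈ in z , ∈-++⁺ʳ t z∈ , eq

  length-cartesianProduct : ∀ {X Y : Set} (l : List X) (l′ : List Y) →
    length (cartesianProduct l l′) ≡ length l * length l′
  length-cartesianProduct []      l′ = refl
  length-cartesianProduct (x ∷ l) l′ =
    trans (length-++ (map (x ,_) l′)) (cong₂ _+_ (length-map (x ,_) l′) (length-cartesianProduct l l′))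

  xor≡true⇒≢ : ∀ a b → a xor b ≡ true → ¬ a ≡ b
  xor≡true⇒≢ true  .true  () refl
  xor≡true⇒≢ false .false () refl

  -- The list `far` has fewer than `2 ^ h` entries, and each is separated by at least `d` vertices,
  -- so `h` halvings with `q` choices each hit them all. A pair that `t` does not separate is
  -- therefore not in `far`.
  separating-set : ∀ {m} (a : Fin (suc m) → Fin (suc m) → Bool) d q h →
    suc m ≤ q * d → suc m * suc m < 2 ^ h →
    ∃ λ t → length t ≤ h * q ×
      (∀ x y → (∀ z → z ∈ t → a z x ≡ a z y) → # (λ z → a z x xor a z y) ≤ d)
  separating-set {m} a d q h n₀≤qd n₀²<2^h =
    let t , t≤ , hit = hitting-set sep d q n₀≤qd h far (≤-<-trans far≤ n₀²<2^h)
                         (λ e∈ → proj₂ (∈-filter⁻ far? {xs = pairs} e∈))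
    in t , t≤ , λ x y agree → close t hit x y agree
    where
    sep : Fin (suc m) → Fin (suc m) × Fin (suc m) → Bool
    sep z (x , y) = a z x xor a z y
    pairs : List (Fin (suc m) × Fin (suc m))
    pairs = cartesianProduct (allFin (suc m)) (allFin (suc m))
    far? : (e : Fin (suc m) × Fin (suc m)) → _
    far? e = d ≤? # (λ z → sep z e)
    far : List (Fin (suc m) × Fin (suc m))
    far = filter far? pairs
    far≤ : length far ≤ suc m * suc m
    far≤ = ≤-trans (length-filter far? pairs) (≤-reflexive
      (trans (length-cartesianProduct (allFin (suc m)) (allFin (suc m)))
        (cong₂ _*_ (length-tabulate {n = suc m} (λ i → i)) (length-tabulate {n = suc m} (λ i → i)))))
    close : ∀ t → (∀ {e} → e ∈ far → ∃ λ z → z ∈ t × sep z e ≡ true) → ∀ x y →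
            (∀ z → z ∈ t → a z x ≡ a z y) → # (λ z → a z x xor a z y) ≤ d
    close t hit x y agree with d ≤? # (λ z → a z x xor a z y)
    ... | no  near = <⇒≤ (≰⇒> near)
    ... | yes isFar with hit (∈-filter⁺ far? (∈-cartesianProduct⁺ (∈-allFin x) (∈-allFin y)) isFar)
    ...   | z , z∈ , eq = contradiction (agree z z∈) (xor≡true⇒≢ (a z x) (a z y) eq)

-- Classes of vertices, the flipped graph, and the isomorphism.

module Structure where

  open import Data.Nat using (_+_; _*_; _^_; _<ᵇ_)
  open import Relation.Binary.Construct.Closure.ReflexiveTransitive using (Star; ε; _◅_; _◅◅_; reverse)
  open Counting

  module _ {A B : Set} where

    any-remove : ∀ {P Q : B → Set} {r} (a : Any P r) → (∀ {y} → P y → ¬ Q y) → Any Q r → Any Q (r ─ a)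
    any-remove (here py)  P⇒¬Q (here qy)  = contradiction qy (P⇒¬Q py)
    any-remove (here py)  P⇒¬Q (there b)  = b
    any-remove {r = _ ∷ _ ∷ _} (there a) P⇒¬Q (here qy) = here qy
    any-remove {r = _ ∷ _ ∷ _} (there a) P⇒¬Q (there b) = there (any-remove a P⇒¬Q b)

    -- Pigeonhole principle: the partner in `r` of the first element is removed, and the other
    -- elements keep their partners because apart elements share none.
    length-≤-apart : (_≋_ : A → B → Set) (Apart : A → A → Set) →
      (∀ {x x′ y} → x ≋ y → x′ ≋ y → ¬ Apart x x′) →
      ∀ {l r} → AllPairs Apart l → All (λ x → Any (x ≋_) r) l → length l ≤ length r
    length-≤-apart _≋_ Apart clash []              []        = z≤n
    length-≤-apart _≋_ Apart clash {r = r} (ax ∷ al) (a ∷ as) =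
      ≤-trans (s≤s (length-≤-apart _≋_ Apart clash al
                     (All.zipWith (λ (apart , b) → any-remove a (λ x≋ x′≋ → clash x≋ x′≋ apart) b) (ax , as))))
              (≤-reflexive (sym (length-removeAt′ r (index a))))

  -- Counting the classes of an equivalence relation

  record Equiv (m : ℕ) : Set₁ where
    field
      _≈_     : Fin m → Fin m → Set
      _≈?_    : ∀ x y → Dec (x ≈ y)
      ≈-refl  : ∀ {x} → x ≈ x
      ≈-sym   : ∀ {x y} → x ≈ y → y ≈ x
      ≈-trans : ∀ {x y z} → x ≈ y → y ≈ z → x ≈ z

  module _ {m : ℕ} where

    open Equiv

    reps : Equiv m → List (Fin m)
    reps E = deduplicate (_≈?_ E) (allFin m)

    #classes : Equiv m → ℕ
    #classes = length ∘ reps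

    reps-apart : ∀ E → AllPairs (λ x y → ¬ _≈_ E x y) (reps E)
    reps-apart E = go (allFin m)
      where
      go : ∀ l → AllPairs (λ x y → ¬ _≈_ E x y) (deduplicate (_≈?_ E) l)
      go []      = []
      go (x ∷ l) = All.all-filter _ (deduplicate (_≈?_ E) l) ∷ AllPairs.filter⁺ _ (go l)

    reps-cover : ∀ E x → Any (_≈_ E x) (reps E)
    reps-cover E x = Any.deduplicate⁺ (_≈?_ E) (λ r p → ≈-trans E p (≈-sym E r)) (lose (∈-allFin x) (≈-refl E))

    apart⇒length≤#classes : ∀ E {l} → AllPairs (λ x y → ¬ _≈_ E x y) l → length l ≤ #classes E
    apart⇒length≤#classes E apart = length-≤-apart (_≈_ E) _
      (λ x≈ x′≈ apart → apart (≈-trans E x≈ (≈-sym E x′≈))) apart (All.tabulate (λ {x} _ → reps-cover E x))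

    _⊑_ : Equiv m → Equiv m → Set
    E′ ⊑ E = ∀ {x y} → _≈_ E′ x y → _≈_ E x y

    #classes-mono : ∀ {E′ E} → E′ ⊑ E → #classes E ≤ #classes E′
    #classes-mono {E′} {E} sub = apart⇒length≤#classes E′ (AllPairs.map (λ ¬E → ¬E ∘ sub) (reps-apart E))

    -- The representatives for `E` stay apart in `E′`. At least one of `y` and `y′` is not
    -- `E′`-equivalent to the representative of their common class and can be added to the list.
    #classes-split : ∀ {E′ E} → E′ ⊑ E → ∀ {y y′} → _≈_ E y y′ → ¬ _≈_ E′ y y′ → #classes E < #classes E′
    #classes-split {E′} {E} sub {y} {y′} y≈y′ y≉y′ = split (find (reps-cover E y))
      where
      apart-unique : ∀ {l x z} → AllPairs (λ x y → ¬ _≈_ E x y) l → x ∈ l → z ∈ l → _≈_ E x z → x ≡ z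
      apart-unique (ax ∷ al) (here refl) (here refl) e = refl
      apart-unique (ax ∷ al) (here refl) (there z∈)  e = contradiction e (All.lookup ax z∈)
      apart-unique (ax ∷ al) (there x∈)  (here refl) e = contradiction (≈-sym E e) (All.lookup ax x∈)
      apart-unique (ax ∷ al) (there x∈)  (there z∈)  e = apart-unique al x∈ z∈ e
      add : ∀ {r e} → r ∈ reps E → _≈_ E e r → ¬ _≈_ E′ e r → #classes E < #classes E′
      add {r} {e} r∈ e≈r e≉r = apart⇒length≤#classes E′ {e ∷ reps E}
        (All.tabulate (λ {r′} r′∈ e≈′r′ → e≉r (subst (_≈_ E′ e)
            (sym (apart-unique (reps-apart E) r∈ r′∈ (≈-trans E (≈-sym E e≈r) (sub e≈′r′)))) e≈′r′))
          ∷ AllPairs.map (λ ¬E → ¬E ∘ sub) (reps-apart E))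
      split : (∃ λ r → r ∈ reps E × _≈_ E y r) → #classes E < #classes E′
      split (r , r∈ , y≈r) with _≈?_ E′ y r
      ... | no  y≉r = add r∈ y≈r y≉r
      ... | yes y≈′r = add r∈ (≈-trans E (≈-sym E y≈y′) y≈r) (λ y′≈r → y≉y′ (≈-trans E′ y≈′r (≈-sym E′ y′≈r)))

    #classes-≤ : ∀ E → #classes E ≤ m
    #classes-≤ E = ≤-trans (length-≤-apart _≡_ (λ x y → ¬ _≈_ E x y)
        (λ { refl refl apart → apart (≈-refl E) }) {r = allFin m} (reps-apart E) (All.tabulate (λ {x} _ → ∈-allFin x)))
      (≤-reflexive (length-tabulate {n = m} id))

    refineBy : Equiv m → (Fin m → Bool) → Equiv m
    refineBy E h = record
      { _≈_ = λ x y → _≈_ E x y × h x ≡ h y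
      ; _≈?_ = λ x y → _≈?_ E x y ×-dec (h x ≟ᵇ h y)
      ; ≈-refl = ≈-refl E , refl
      ; ≈-sym = λ (e , eq) → ≈-sym E e , sym eq
      ; ≈-trans = λ (e , eq) (e′ , eq′) → ≈-trans E e e′ , trans eq eq′ }

  #-witness : ∀ {m} (P : Fin m → Bool) → 1 ≤ # P → ∃ λ i → P i ≡ true
  #-witness {suc m} P 1≤ with P fz in eq
  ... | true  = fz , eq
  ... | false = let i , pi = #-witness (P ∘ fs) 1≤ in fs i , pi

  #-positive : ∀ {m} (P : Fin m → Bool) i → P i ≡ true → 1 ≤ # P
  #-positive {suc m} P fz     eq rewrite eq = s≤s z≤n
  #-positive {suc m} P (fs i) eq = ≤-trans (#-positive (P ∘ fs) i eq) (m≤n+m _ _)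

  #-mono : ∀ {m} {P Q : Fin m → Bool} → (∀ i → P i ≡ true → Q i ≡ true) → # P ≤ # Q
  #-mono {P = P} {Q} P⇒Q = sum-mono λ i → le i
    where
    le : ∀ i → 𝟙 (P i) ≤ 𝟙 (Q i)
    le i with P i in eq
    ... | false = z≤n
    ... | true rewrite P⇒Q i eq = ≤-refl

  length-filter-allFin : ∀ {m} {P : Fin m → Set} (P? : ∀ x → Dec (P x)) →
    length (filter P? (allFin m)) ≡ # (does ∘ P?)
  length-filter-allFin P? = go P? id
    where
    go : ∀ {m m′} {P : Fin m → Set} (P? : ∀ x → Dec (P x)) (f : Fin m′ → Fin m) →
         length (filter P? (tabulate f)) ≡ # (does ∘ P? ∘ f)
    go {m′ = zero}  P? f = refl
    go {m′ = suc m′} P? f with does (P? (f fz))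
    ... | true  = cong suc (go P? (f ∘ fs))
    ... | false = go P? (f ∘ fs)

  length-filter-< : ∀ {A : Set} {P Q : A → Set} (P? : ∀ x → Dec (P x)) (Q? : ∀ x → Dec (Q x)) →
    (∀ {x} → P x → Q x) → ∀ {l x} → x ∈ l → Q x → ¬ P x → length (filter P? l) < length (filter Q? l)
  length-filter-< {P = P} {Q} P? Q? P⇒Q = go
    where
    mono : ∀ l → length (filter P? l) ≤ length (filter Q? l)
    mono [] = z≤n
    mono (y ∷ l) with P? y | Q? y
    ... | yes p | yes q = s≤s (mono l)
    ... | yes p | no ¬q = contradiction (P⇒Q p) ¬q
    ... | no ¬p | yes q = m≤n⇒m≤1+n (mono l)
    ... | no ¬p | no ¬q = mono l
    go : ∀ {l x} → x ∈ l → Q x → ¬ P x → length (filter P? l) < length (filter Q? l)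
    go {y ∷ l} x∈ qx ¬px with P? y | Q? y
    go {y ∷ l} (here refl) qx ¬px | yes p | _ = contradiction p ¬px
    go {y ∷ l} (here refl) qx ¬px | no _  | no ¬q = contradiction qx ¬q
    go {y ∷ l} (here refl) qx ¬px | no _  | yes _ = s≤s (mono l)
    go {y ∷ l} (there x∈) qx ¬px | yes p | yes q = s≤s (go x∈ qx ¬px)
    go {y ∷ l} (there x∈) qx ¬px | yes p | no ¬q = contradiction (P⇒Q p) ¬q
    go {y ∷ l} (there x∈) qx ¬px | no ¬p | yes q = m≤n⇒m≤1+n (go x∈ qx ¬px)
    go {y ∷ l} (there x∈) qx ¬px | no ¬p | no ¬q = go x∈ qx ¬px

  does-≡ : ∀ {A B : Set} (A? : Dec A) (B? : Dec B) → (A → B) → (B → A) → does A? ≡ does B?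
  does-≡ (yes a) (yes b) f g = refl
  does-≡ (yes a) (no ¬b) f g = contradiction (f a) ¬b
  does-≡ (no ¬a) (yes b) f g = contradiction (g b) ¬a
  does-≡ (no ¬a) (no ¬b) f g = refl

  -- Classes over a set of pebbled vertices.

  module Types {G H : ColoredGraph} {K : ℕ} (ge : GameEquivalence G H K) where

    open GameEquivalence ge public

    infix 4 _⊢_~_
    _⊢_~_ : List V → V → V → Set
    s ⊢ x ~ y = Good true ((x , y) ∷ diag s)

    private
      undiag : ∀ (s : List V) → diag (map proj₁ (diag s)) ≡ diag s
      undiag s = cong diag (map-proj₁-diag s)

    types : List V → Equiv (n G)
    types s = record
      { _≈_ = s ⊢_~_
      ; _≈?_ = λ x y → good? true _
      ; ≈-refl = λ {x} → good-refl (x ∷ s)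
      ; ≈-sym = λ {x} {y} e → subst (λ l → Good true ((y , x) ∷ l)) (undiag s)
                                 (good-join {true} {diag s} (good-refl (y ∷ s)) e)
      ; ≈-trans = λ {x} {y} e e′ → good-trans {true} {diag s}
                      (subst (λ l → Good true ((x , y) ∷ l)) (sym (undiag s)) e) e′ }

    push : ∀ {b p} → length p < K → Good b p → ∀ x → ∃ λ y → Good b ((x , y) ∷ p)
    push lp g x = let f , h = good-ext lp g in to f x , h x

    pull : ∀ {b p} → length p < K → Good b p → ∀ y → ∃ λ x → Good b ((x , y) ∷ p)
    pull {b} {p} lp g y = let f , h = good-ext lp g in
      from f y , subst (λ z → Good b ((from f y , z) ∷ p)) (strictlyInverseˡ f y) (h (from f y))

    pebble : ∀ {b q} l → length l + length q ≤ K → Good b q →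
      ∃ λ r → map proj₁ r ≡ l × Good b (r ++ q)
    pebble []      len g = [] , refl , g
    pebble {b} {q} (x ∷ l) len g =
      let r , eq , g′ = pebble l (≤-trans (n≤1+n _) len) g
          len′ = ≤-trans (≤-reflexive (cong suc (trans (length-++ r)
                   (cong (_+ length q) (trans (sym (length-map proj₁ r)) (cong length eq)))))) len
          y , g″ = push len′ g′ x
      in (x , y) ∷ r , cong (x ∷_) eq , g″

    -- Each individualisation that creates four new classes is paid for by them.
    greedy : ∀ f s → n G < #classes (types s) + 4 * suc f → ∃ λ s′ →
      length s′ ≤ f + length s × (∀ {z} → z ∈ s → z ∈ s′) ×
      (∀ x → #classes (types (x ∷ s′)) ≤ 3 + #classes (types s′))
    greedy f s bound with any? (λ x → 4 + #classes (types s) ≤? #classes (types (x ∷ s)))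
    greedy f s bound | no stuck = s , m≤n+m _ f , id , λ x → ≤-pred (≰⇒> (λ le → stuck (x , le)))
    greedy zero s bound | yes (x , le) = contradiction (≤-trans bound (≤-trans (≤-reflexive (+-comm _ 4)) le))
      (<⇒≱ (s≤s (#classes-≤ (types (x ∷ s)))))
    greedy (suc f) s bound | yes (x , le) =
      let s′ , len , sub , stuck = greedy f (x ∷ s) (≤-trans bound (≤-trans (≤-reflexive eq) (+-monoˡ-≤ (4 * suc f) le)))
      in s′ , ≤-trans len (≤-reflexive (+-suc f _)) , sub ∘ there , stuck
      where
      rearrange : ∀ c f → c + 4 * suc (suc f) ≡ 4 + c + 4 * suc f
      rearrange = solve-∀
      eq : #classes (types s) + 4 * suc (suc f) ≡ 4 + #classes (types s) + 4 * suc f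
      eq = rearrange (#classes (types s)) f

  -- The flipped graph Γ when no vertex creates four new classes.

  module Stuck {G H : ColoredGraph} {K : ℕ} (ge : GameEquivalence G H K)
    (s : List (Fin (n G))) (room : 4 + length (diag s) ≤ K) (d : ℕ)
    (close : ∀ x y → Types._⊢_~_ ge s x y → # (λ z → adj G z x xor adj G z y) ≤ d)
    (stuck : ∀ x → #classes (Types.types ge (x ∷ s)) ≤ 3 + #classes (Types.types ge s)) where

    open Types ge

    infix 4 _~ᵇ_
    open Equiv (types s) public using () renaming (_≈_ to infix 4 _~_; _≈?_ to infix 4 _~?_; ≈-refl to ~-refl; ≈-sym to ~-sym; ≈-trans to ~-trans)

    _~ᵇ_ : V → V → Bool
    x ~ᵇ y = does (x ~? y)

    room₁ : 1 + length (diag s) ≤ K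
    room₁ = ≤-trans (+-monoˡ-≤ _ (s≤s z≤n)) room

    room₂ : 2 + length (diag s) ≤ K
    room₂ = ≤-trans (+-monoˡ-≤ _ (s≤s (s≤s z≤n))) room

    room₃ : 3 + length (diag s) ≤ K
    room₃ = ≤-trans (+-monoˡ-≤ _ (s≤s (s≤s (s≤s z≤n)))) room

    forget : ∀ {u v x y} → Good true ((u , v) ∷ (x , y) ∷ diag s) → u ~ v
    forget = good-⊆ room₁ room₂ λ { (here eq) → here eq ; (there e∈) → there (there e∈) }

    forget′ : ∀ {u v x y} → Good true ((u , v) ∷ (x , y) ∷ diag s) → x ~ y
    forget′ = good-⊆ room₁ room₂ there

    forget₃ : ∀ {u v x y w w′} → Good true ((w , w′) ∷ (u , v) ∷ (x , y) ∷ diag s) → Good true ((w , w′) ∷ (x , y) ∷ diag s)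
    forget₃ = good-⊆ room₂ room₃ λ { (here eq) → here eq ; (there e∈) → there (there e∈) }

    forget₃′ : ∀ {u v x y w w′} → Good true ((w , w′) ∷ (u , v) ∷ (x , y) ∷ diag s) → Good true ((w , w′) ∷ (u , v) ∷ diag s)
    forget₃′ = good-⊆ room₂ room₃ λ { (here eq) → here eq ; (there (here eq)) → there (here eq) ; (there (there e∈)) → there (there (there e∈)) }

    ~ᵇ-cong : ∀ {x y} v → x ~ y → (v ~ᵇ x) ≡ (v ~ᵇ y)
    ~ᵇ-cong v x~y = does-≡ (v ~? _) (v ~? _) (λ v~x → ~-trans v~x x~y) (λ v~y → ~-trans v~y (~-sym x~y))

    ~ᵇ-congˡ : ∀ {v v′} x → v ~ v′ → (v ~ᵇ x) ≡ (v′ ~ᵇ x)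
    ~ᵇ-congˡ x v~v′ = does-≡ (_ ~? x) (_ ~? x) (~-trans (~-sym v~v′)) (~-trans v~v′)

    -- Homogeneity of the classes

    size : V → ℕ
    size x = # (λ v → v ~ᵇ x)

    deg : V → V → ℕ
    deg x c = # (λ v → adj G x v ∧ (v ~ᵇ c))

    size-cong : ∀ {x y} → x ~ y → size x ≡ size y
    size-cong x~y = sum-cong-≗ (λ v → cong 𝟙 (~ᵇ-cong v x~y))

    size-positive : ∀ x → 1 ≤ size x
    size-positive x = #-positive (λ v → v ~ᵇ x) x (dec-true (x ~? x) ~-refl)

    deg-congʳ : ∀ x {c c′} → c ~ c′ → deg x c ≡ deg x c′
    deg-congʳ x c~c′ = sum-cong-≗ (λ v → cong (λ b → 𝟙 (adj G x v ∧ b)) (~ᵇ-cong v c~c′))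

    -- With `x` and `y` pebbled, Duplicator's bijection preserves classes and adjacency to the
    -- pebbles, so it carries the neighbours of `x` in the class of `c` to those of `y`.
    deg-congˡ : ∀ {x y} c → x ~ y → deg x c ≡ deg y c
    deg-congˡ {x} {y} c x~y = let f , h = good-ext room₂ x~y in
      trans (sum-cong-≗ (λ v → cong₂ (λ b b′ → 𝟙 (b ∧ b′))
              (good-adj room₂ (h v) (there (here refl)) (here refl)) (~ᵇ-congˡ c (forget (h v)))))
            (sym (sum-permute (λ v → 𝟙 (adj G y v ∧ (v ~ᵇ c))) f))

    -- Both sides count the adjacent pairs between the two classes, once from each end; by
    -- `deg-congˡ` all vertices of a class contribute equally.
    size-deg : ∀ x y → size x * deg x y ≡ size y * deg y x
    size-deg x y = trans (sym (total x y)) (trans (∑-comm (term x y)) (trans (sum-cong-≗ (λ v → sum-cong-≗ (λ u → swap u v))) (total y x)))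
      where
      term : V → V → V → V → ℕ
      term x y u v = 𝟙 (u ~ᵇ x) * 𝟙 (adj G u v ∧ (v ~ᵇ y))
      swap : ∀ u v → term x y u v ≡ term y x v u
      swap u v rewrite adj-sym G u v with u ~ᵇ x | v ~ᵇ y | adj G v u
      ... | true  | true  | true  = refl
      ... | true  | true  | false = refl
      ... | true  | false | true  = refl
      ... | true  | false | false = refl
      ... | false | true  | true  = refl
      ... | false | true  | false = refl
      ... | false | false | true  = refl
      ... | false | false | false = refl
      total : ∀ x y → sum (λ u → sum (term x y u)) ≡ size x * deg x y
      total x y = trans (sum-cong-≗ row) (trans (sum-*ˡ (deg x y) (λ u → 𝟙 (u ~ᵇ x))) (*-comm (deg x y) (size x)))
        where
        row : ∀ u → sum (term x y u) ≡ deg x y * 𝟙 (u ~ᵇ x)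
        row u = trans (sum-*ˡ (𝟙 (u ~ᵇ x)) (λ v → 𝟙 (adj G u v ∧ (v ~ᵇ y)))) (eq (u ~? x))
          where
          eq : (u~?x : Dec (u ~ x)) → 𝟙 (does u~?x) * deg u y ≡ deg x y * 𝟙 (does u~?x)
          eq (yes u~x) = trans (*-comm 1 (deg u y)) (cong (_* 1) (deg-congˡ y u~x))
          eq (no  _)   = sym (*-zeroʳ (deg x y))

    -- Flipping the adjacency between two classes that are mostly adjacent leaves a
    -- graph Γ of small degree, from which G is recovered by flipping back.

    maj : V → V → Bool
    maj x c = size c <ᵇ 2 * deg x c

    maj-congˡ : ∀ {x y} c → x ~ y → maj x c ≡ maj y c
    maj-congˡ c x~y = cong (λ e → size c <ᵇ 2 * e) (deg-congˡ c x~y)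

    maj-congʳ : ∀ x {c c′} → c ~ c′ → maj x c ≡ maj x c′
    maj-congʳ x c~c′ = cong₂ (λ a e → a <ᵇ 2 * e) (size-cong c~c′) (deg-congʳ x c~c′)

    -- By `size-deg` the densities `deg x y / size y` and `deg y x / size x` coincide, and `maj`
    -- compares this density with one half.
    maj-sym : ∀ x y → maj x y ≡ maj y x
    maj-sym x y = does-≡ (size y <? 2 * deg x y) (size x <? 2 * deg y x) (half x y) (half y x)
      where
      half : ∀ x y → size y < 2 * deg x y → size x < 2 * deg y x
      half x y lt = *-cancelˡ-< (size y) _ _ (subst₂ _<_ (*-comm (size x) (size y)) eq
                      (*-monoʳ-< (size x) ⦃ >-nonZero (size-positive x) ⦄ lt))
        where
        swap : ∀ a b → a * (2 * b) ≡ 2 * (a * b)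
        swap = solve-∀
        eq : size x * (2 * deg x y) ≡ size y * (2 * deg y x)
        eq = trans (swap (size x) _) (trans (cong (2 *_) (size-deg x y)) (sym (swap (size y) _)))

    agree : V → V → V → Bool
    agree x c v = (v ~ᵇ c) ∧ not (adj G x v xor maj x c)

    majority : ∀ x c → size c ≤ 2 * # (agree x c)
    majority x c with maj x c in eq
    ... | true  = ≤-trans (<⇒≤ (<ᵇ⇒< (size c) _ (Equivalence.from T-≡ eq))) (*-monoʳ-≤ 2 (≤-reflexive (sum-cong-≗ pointwise)))
      where
      pointwise : ∀ v → 𝟙 (adj G x v ∧ (v ~ᵇ c)) ≡ 𝟙 ((v ~ᵇ c) ∧ not (adj G x v xor true))
      pointwise v with adj G x v | v ~ᵇ c
      ... | true  | true  = refl
      ... | true  | false = refl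
      ... | false | true  = refl
      ... | false | false = refl
    ... | false = begin
      size c           ≡⟨ split ⟩
      deg x c + rest   ≤⟨ +-monoˡ-≤ rest deg≤rest ⟩
      rest + rest      ≡⟨ cong (rest +_) (sym (+-identityʳ rest)) ⟩
      2 * rest         ∎
      where
      open ≤-Reasoning
      rest : ℕ
      rest = # (λ v → (v ~ᵇ c) ∧ not (adj G x v xor false))
      pointwise : ∀ v → 𝟙 (v ~ᵇ c) ≡ 𝟙 (adj G x v ∧ (v ~ᵇ c)) + 𝟙 ((v ~ᵇ c) ∧ not (adj G x v xor false))
      pointwise v with adj G x v | v ~ᵇ c
      ... | true  | true  = refl
      ... | true  | false = refl
      ... | false | true  = refl
      ... | false | false = refl
      split : size c ≡ deg x c + rest
      split = trans (sum-cong-≗ pointwise) (∑-distrib-+ (λ v → 𝟙 (adj G x v ∧ (v ~ᵇ c))) _)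
      deg≤rest : deg x c ≤ rest
      deg≤rest = +-cancelˡ-≤ (deg x c) _ _ (begin
        deg x c + deg x c  ≡⟨ cong (deg x c +_) (sym (+-identityʳ (deg x c))) ⟩
        2 * deg x c        ≤⟨ ≮⇒≥ (λ lt → not-¬ eq (Equivalence.to T-≡ (<⇒<ᵇ lt))) ⟩
        size c             ≡⟨ split ⟩
        deg x c + rest     ∎)

    agree⇒ : ∀ x c v → agree x c v ≡ true → v ~ c × adj G x v ≡ maj x c
    agree⇒ x c v eq with v ~? c | adj G x v | maj x c
    ... | yes v~c | true  | true  = v~c , refl
    ... | yes v~c | false | false = v~c , refl

    -- Supplies in every class a vertex that is not joined to `x` in Γ, which shows that pebbling
    -- `x` properly splits each class containing a Γ-neighbour of `x`.
    majority-witness : ∀ x c → ∃ λ v → v ~ c × adj G x v ≡ maj x c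
    majority-witness x c =
      let v , eq = #-witness (agree x c) (positive (≤-trans (size-positive c) (majority x c)))
      in v , agree⇒ x c v eq
      where
      positive : ∀ {a} → 1 ≤ 2 * a → 1 ≤ a
      positive {suc a} _ = s≤s z≤n

    -- Loops are excluded explicitly: `adj G x x` is false, but `maj x x` is true inside a class
    -- that is mostly adjacent to itself.
    Γ : V → V → Set
    Γ x y = x ≢ y × adj G x y ≢ maj x y

    Γ? : ∀ x y → Dec (Γ x y)
    Γ? x y = ¬? (x ≟ᶠ y) ×-dec ¬? (adj G x y ≟ᵇ maj x y)

    Γ-sym : ∀ {x y} → Γ x y → Γ y x
    Γ-sym {x} {y} (x≢y , a≢m) = ≢-sym x≢y , λ eq → a≢m (trans (adj-sym G x y) (trans eq (maj-sym y x)))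

    ¬Γ⇒adj≡maj : ∀ {x y} → x ≢ y → ¬ Γ x y → adj G x y ≡ maj x y
    ¬Γ⇒adj≡maj {x} {y} x≢y ¬Γ = decidable-stable (adj G x y ≟ᵇ maj x y) (λ ne → ¬Γ (x≢y , ne))

    Γ-invariant : ∀ {u v x y} → Good true ((u , v) ∷ (x , y) ∷ diag s) → Γ x u → Γ y v
    Γ-invariant {u} {v} {x} {y} g (x≢u , a≢m) =
      (λ { refl → x≢u (good-inj room₂ g (there (here refl)) (here refl)) }) ,
      (λ eq → a≢m (trans (good-adj room₂ g (there (here refl)) (here refl))
        (trans eq (sym (trans (maj-congˡ u (forget′ g)) (maj-congʳ y (forget g)))))))

    neighbours : V → List V
    neighbours x = filter (Γ? x) (allFin (n G))

    -- If Γ x z then at least half of the class of x is separated from x by z.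
    Γ-degree : ∀ x → length (neighbours x) ≤ 2 * d
    Γ-degree x = *-cancelʳ-≤ _ _ (size x) ⦃ >-nonZero (size-positive x) ⦄ (begin
      length (neighbours x) * size x                     ≡⟨ cong (_* size x) (length-filter-allFin (Γ? x)) ⟩
      # (does ∘ Γ? x) * size x                           ≡⟨ *-comm (# (does ∘ Γ? x)) (size x) ⟩
      size x * # (does ∘ Γ? x)                           ≡⟨ sum-*ˡ (size x) (𝟙 ∘ does ∘ Γ? x) ⟨
      sum (λ z → size x * 𝟙 (does (Γ? x z)))             ≤⟨ sum-mono (λ z → separated z (Γ? x z)) ⟩
      sum (λ z → 2 * # (λ y → sep z y))                  ≡⟨ sum-*ˡ 2 (λ z → # (λ y → sep z y)) ⟩
      -- Now each `y` in the class of `x` is charged with the vertices that separate it from `x`, at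
      -- most `d` by `close`.
      2 * sum (λ z → # (λ y → sep z y))                  ≡⟨ cong (2 *_) (∑-comm (λ z y → 𝟙 (sep z y))) ⟩
      2 * sum (λ y → # (λ z → sep z y))                  ≤⟨ *-monoʳ-≤ 2 (sum-mono (λ y → few y (y ~? x))) ⟩
      2 * sum (λ y → d * 𝟙 (y ~ᵇ x))                     ≡⟨ cong (2 *_) (sum-*ˡ d (λ y → 𝟙 (y ~ᵇ x))) ⟩
      2 * (d * size x)                                   ≡⟨ *-assoc 2 d (size x) ⟨
      2 * d * size x                                     ∎)
      where
      open ≤-Reasoning
      sep : V → V → Bool
      sep z y = (y ~ᵇ x) ∧ (adj G z x xor adj G z y)
      separated : ∀ z (γ? : Dec (Γ x z)) → size x * 𝟙 (does γ?) ≤ 2 * # (λ y → sep z y)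
      separated z (no  _) = ≤-trans (≤-reflexive (*-zeroʳ (size x))) z≤n
      separated z (yes γ) = ≤-trans (≤-reflexive (*-identityʳ (size x)))
        (≤-trans (majority z x) (*-monoʳ-≤ 2 (#-mono (λ v eq → sep-true v (agree⇒ z x v eq)))))
        where
        sep-true : ∀ v → v ~ x × adj G z v ≡ maj z x → sep z v ≡ true
        sep-true v (v~x , eq) rewrite dec-true (v ~? x) v~x | eq =
          different (proj₂ (Γ-sym γ))
          where
          different : ∀ {a b : Bool} → a ≢ b → a xor b ≡ true
          different {true}  {true}  ne = contradiction refl ne
          different {true}  {false} ne = refl
          different {false} {true}  ne = refl
          different {false} {false} ne = contradiction refl ne
      few : ∀ y (y~?x : Dec (y ~ x)) → # (λ z → does y~?x ∧ (adj G z x xor adj G z y)) ≤ d * 𝟙 (does y~?x)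
      few y (yes y~x) = ≤-trans (close x y (~-sym y~x)) (≤-reflexive (sym (*-identityʳ d)))
      few y (no  _)   = ≤-trans (≤-reflexive (trans (sum-*ˡ {m = n G} 0 (λ _ → 0)) refl)) z≤n

    -- Balls in Γ

    ball : ℕ → V → List V
    ball zero    x = x ∷ []
    ball (suc j) x = concatMap (λ z → z ∷ neighbours z) (ball j x)

    length-ball : ∀ j x → length (ball j x) ≤ (1 + 2 * d) ^ j
    length-ball zero    x = ≤-refl
    length-ball (suc j) x = ≤-trans (go (ball j x)) (*-monoʳ-≤ (1 + 2 * d) (length-ball j x))
      where
      go : ∀ l → length (concatMap (λ z → z ∷ neighbours z) l) ≤ (1 + 2 * d) * length l
      go []      = z≤n
      go (z ∷ l) = ≤-trans (≤-reflexive (length-++ (z ∷ neighbours z)))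
        (≤-trans (+-mono-≤ (s≤s (Γ-degree z)) (go l)) (≤-reflexive (sym (*-suc (1 + 2 * d) (length l)))))

    ball-stay : ∀ {j x u} → u ∈ ball j x → u ∈ ball (suc j) x
    ball-stay u∈ = ∈-concatMap⁺ (λ z → z ∷ neighbours z) (Any.map (λ { refl → here refl }) u∈)

    ball-step : ∀ {j x u v} → u ∈ ball j x → Γ u v → v ∈ ball (suc j) x
    ball-step {u = u} {v} u∈ γ = ∈-concatMap⁺ (λ z → z ∷ neighbours z)
      (Any.map (λ { refl → there (∈-filter⁺ (Γ? u) (∈-allFin v) γ) }) u∈)

    ball-pred : ∀ {j x v} → v ∈ ball (suc j) x → v ∈ ball j x ⊎ ∃ λ u → u ∈ ball j x × Γ u v
    ball-pred {j} {x} v∈ with find (∈-concatMap⁻ (λ z → z ∷ neighbours z) {xs = ball j x} v∈)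
    ... | u , u∈ , here refl = inj₁ u∈
    ... | u , u∈ , there v∈′ = inj₂ (u , u∈ , proj₂ (∈-filter⁻ (Γ? u) {xs = allFin (n G)} v∈′))

    ball-mono : ∀ {i j x u} → i ≤ j → u ∈ ball i x → u ∈ ball j x
    ball-mono {i} {x = x} {u} i≤j u∈ = go (≤⇒≤′ i≤j)
      where
      go : ∀ {j} → i ℕ.≤′ j → u ∈ ball j x
      go (ℕ.≤′-reflexive refl) = u∈
      go (ℕ.≤′-step {j} i≤′j) = ball-stay {j} {x} (go i≤′j)

    ball-trans : ∀ {i x u} j {v} → u ∈ ball i x → v ∈ ball j u → v ∈ ball (j + i) x
    ball-trans {x = x} zero u∈ (here refl) = u∈
    ball-trans {i} {x} {u} (suc j) u∈ v∈ with ball-pred {j} {u} v∈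
    ... | inj₁ v∈′           = ball-stay {j + i} {x} (ball-trans j u∈ v∈′)
    ... | inj₂ (w , w∈ , γ)  = ball-step {j + i} {x} (ball-trans j u∈ w∈) γ

    ball-sym : ∀ j {x u} → u ∈ ball j x → x ∈ ball j u
    ball-sym zero (here refl) = here refl
    ball-sym (suc j) {x} {u} u∈ with ball-pred {j} {x} u∈
    ... | inj₁ u∈′ = ball-stay {j} {u} (ball-sym j u∈′)
    ... | inj₂ (w , w∈ , γ) = subst (λ i → x ∈ ball i u) (+-comm j 1)
            (ball-trans {1} {u} {w} j (ball-step {0} {u} (here refl) (Γ-sym γ)) (ball-sym j w∈))

    -- A path from `x` is followed with pebbles on `x` and on the current vertex, plus one for the
    -- next vertex. Hence three pebbles beyond `s` recognise balls of every radius.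
    ball-invariant : ∀ j {u v x y} → Good true ((u , v) ∷ (x , y) ∷ diag s) → u ∈ ball j x → v ∈ ball j y
    ball-invariant zero g (here refl) = here (sym (good-fun room₂ g (there (here refl)) (here refl)))
    ball-invariant (suc j) {u} {v} {x} {y} g u∈ with ball-pred {j} {x} u∈
    ... | inj₁ u∈′ = ball-stay {j} {y} (ball-invariant j g u∈′)
    ... | inj₂ (w , w∈ , γ) = let w′ , g′ = push room₃ g w in
            ball-step {j} {y} (ball-invariant j (forget₃ g′) w∈) (Γ-invariant (flip (forget₃′ g′)) γ)
      where
      flip : ∀ {e e′} → Good true (e ∷ e′ ∷ diag s) → Good true (e′ ∷ e ∷ diag s)
      flip = good-⊆ room₂ room₂ λ { (here eq) → there (here eq) ; (there (here eq)) → here eq ; (there (there e∈)) → there (there e∈) }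

    ball⇒Star : ∀ j {x u} → u ∈ ball j x → Star Γ x u
    ball⇒Star zero (here refl) = ε
    ball⇒Star (suc j) {x} u∈ with ball-pred {j} {x} u∈
    ... | inj₁ u∈′ = ball⇒Star j u∈′
    ... | inj₂ (w , w∈ , γ) = ball⇒Star j w∈ ◅◅ (γ ◅ ε)

    -- Consequences of being stuck

    Invariant : V → (V → Bool) → Set
    Invariant x h = ∀ {u v} → (x ∷ s) ⊢ u ~ v → h u ≡ h v

    _⊓_ : Equiv (n G) → (V → Bool) → Equiv (n G)
    _⊓_ = refineBy

    infixl 5 _⊓_
    open Equiv using (_≈_)

    -- Each function splits a class left by the earlier ones, so the gains add up to four classes.
    -- By invariance `types (x ∷ s)` refines the result, whereas `stuck` allows three new classes.
    four-splits : ∀ x (h₀ h₁ h₂ h₃ : V → Bool) →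
      Invariant x h₀ → Invariant x h₁ → Invariant x h₂ → Invariant x h₃ →
      ∀ {y₀ y₀′ y₁ y₁′ y₂ y₂′ y₃ y₃′} →
      _≈_ (types s) y₀ y₀′ → h₀ y₀ ≢ h₀ y₀′ →
      _≈_ (types s ⊓ h₀) y₁ y₁′ → h₁ y₁ ≢ h₁ y₁′ →
      _≈_ (types s ⊓ h₀ ⊓ h₁) y₂ y₂′ → h₂ y₂ ≢ h₂ y₂′ →
      _≈_ (types s ⊓ h₀ ⊓ h₁ ⊓ h₂) y₃ y₃′ → h₃ y₃ ≢ h₃ y₃′ → ⊥
    four-splits x h₀ h₁ h₂ h₃ i₀ i₁ i₂ i₃ e₀ n₀ e₁ n₁ e₂ n₂ e₃ n₃ =
      <⇒≱ (≤-trans (s≤s (≤-trans (s≤s (≤-trans (s≤s (split (types s) h₀ e₀ n₀)) (split (types s ⊓ h₀) h₁ e₁ n₁))) (split (types s ⊓ h₀ ⊓ h₁) h₂ e₂ n₂)))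
            (≤-trans (split (types s ⊓ h₀ ⊓ h₁ ⊓ h₂) h₃ e₃ n₃)
              (#classes-mono {E′ = types (x ∷ s)} {E = types s ⊓ h₀ ⊓ h₁ ⊓ h₂ ⊓ h₃} (λ g → ((((forget g , i₀ g) , i₁ g) , i₂ g) , i₃ g)))))
          (stuck x)
      where
      split : ∀ E h {y y′} → _≈_ E y y′ → h y ≢ h y′ → #classes E < #classes (E ⊓ h)
      split E h e ne = #classes-split {E′ = E ⊓ h} {E = E} proj₁ e (ne ∘ proj₂)

    module _ (z : V) where
      open DecMembership (_≟ᶠ_ {n G}) using (_∈?_)

      private
        h : ℕ → V → Bool
        h j u = does (u ∈? ball j z)

        h-invariant : ∀ j → Invariant z (h j)
        h-invariant j g = does-≡ (_ ∈? ball j z) (_ ∈? ball j z) (ball-invariant j g)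
          (ball-invariant j (Equiv.≈-sym (types (z ∷ s)) g))

        Inside : V → Set
        Inside z′ = z′ ∈ ball 6 z

        Unsplit : ℕ → V → Set
        Unsplit j y = ∀ y′ → y ~ y′ → y′ ∈ ball j z

        split? : ∀ j y → Unsplit j y ⊎ ∃ λ y′ → y ~ y′ × y′ ∉ ball j z
        split? j y with any? (λ y′ → (y ~? y′) ×-dec ¬? (y′ ∈? ball j z))
        ... | yes found = inj₂ found
        ... | no  none  = inj₁ λ y′ y~y′ → decidable-stable (y′ ∈? ball j z) (λ y′∉ → none (y′ , y~y′ , y′∉))

        -- A z′ equivalent to z also has a vertex equivalent to y at distance at most j.
        unsplit⇒inside : ∀ {j y} → j ≤ 3 → y ∈ ball j z → Unsplit j y → ∀ {z′} → z ~ z′ → Inside z′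
        unsplit⇒inside {j} {y} j≤3 y∈ unsplit z~z′ =
          let y′ , g = push room₂ z~z′ y
              y′∈z′  = ball-invariant j g y∈
              y′∈z   = unsplit y′ (forget g)
          in ball-mono {x = z} (+-mono-≤ j≤3 j≤3) (ball-trans {j} {z} j y′∈z (ball-sym j y′∈z′))

        prev : ∀ {j y} → y ∈ ball (suc (suc j)) z → y ∉ ball (suc j) z → ∃ λ y′ → y′ ∈ ball (suc j) z × y′ ∉ ball j z
        prev {j} y∈ y∉ with ball-pred {suc j} {z} y∈
        ... | inj₁ y∈′ = contradiction y∈′ y∉
        ... | inj₂ (w , w∈ , γ) = w , w∈ , λ w∈′ → y∉ (ball-step {j} {z} w∈′ γ)

      -- Take `z`, `y₁`, `y₂`, `y₃` at distances 0, 1, 2, 3 from `z`. If each had an equivalent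
      -- vertex outside the ball of its own radius, then membership in the four balls would give
      -- four splits. So for some `j ≤ 3` the class of the vertex at distance `j` stays in the ball
      -- of radius `j`; every `z′` equivalent to `z` is within `j` of that class, hence within
      -- `2 * j ≤ 6` of `z`.
      class-in-ball : (∃ λ y → y ∈ ball 3 z × y ∉ ball 2 z) → ∀ {z′} → z ~ z′ → z′ ∈ ball 6 z
      class-in-ball (y₃ , y₃∈ , y₃∉) {z′} z~z′ with prev {1} y₃∈ y₃∉
      ... | y₂ , y₂∈ , y₂∉ with prev {0} y₂∈ y₂∉
      ... | y₁ , y₁∈ , y₁∉ with split? 0 z | split? 1 y₁ | split? 2 y₂ | split? 3 y₃
      ... | inj₁ un | _ | _ | _ = unsplit⇒inside z≤n (here refl) un z~z′
      ... | inj₂ _ | inj₁ un | _ | _ = unsplit⇒inside (s≤s z≤n) y₁∈ un z~z′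
      ... | inj₂ _ | inj₂ _ | inj₁ un | _ = unsplit⇒inside (s≤s (s≤s z≤n)) y₂∈ un z~z′
      ... | inj₂ _ | inj₂ _ | inj₂ _ | inj₁ un = unsplit⇒inside ≤-refl y₃∈ un z~z′
      ... | inj₂ (u₀ , e₀ , o₀) | inj₂ (u₁ , e₁ , o₁) | inj₂ (u₂ , e₂ , o₂) | inj₂ (u₃ , e₃ , o₃) =
        ⊥-elim (four-splits z (h 0) (h 1) (h 2) (h 3) (h-invariant 0) (h-invariant 1) (h-invariant 2) (h-invariant 3)
          e₀ (differ {0} (here refl) o₀)
          (e₁ , both {0} y₁∉ (o₁ ∘ ball-stay {0} {z})) (differ {1} y₁∈ o₁)
          ((e₂ , both {0} (y₂∉ ∘ ball-stay {0} {z}) (o₂ ∘ ball-stay {1} {z} ∘ ball-stay {0} {z})) ,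
            both {1} y₂∉ (o₂ ∘ ball-stay {1} {z})) (differ {2} y₂∈ o₂)
          (((e₃ , both {0} (y₃∉ ∘ ball-stay {1} {z} ∘ ball-stay {0} {z})
                           (o₃ ∘ ball-stay {2} {z} ∘ ball-stay {1} {z} ∘ ball-stay {0} {z})) ,
            both {1} (y₃∉ ∘ ball-stay {1} {z}) (o₃ ∘ ball-stay {2} {z} ∘ ball-stay {1} {z})) ,
            both {2} y₃∉ (o₃ ∘ ball-stay {2} {z})) (differ {3} y₃∈ o₃))
        where
        differ : ∀ {j u v} → u ∈ ball j z → v ∉ ball j z → h j u ≢ h j v
        differ {j} {u} {v} u∈ v∉ eq with trans (sym (dec-true (u ∈? ball j z) u∈)) (trans eq (dec-false (v ∈? ball j z) v∉))
        ... | ()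
        both : ∀ {j u v} → u ∉ ball j z → v ∉ ball j z → h j u ≡ h j v
        both {j} {u} {v} u∉ v∉ = trans (dec-false (u ∈? ball j z) u∉) (sym (dec-false (v ∈? ball j z) v∉))

    -- The vertex a splits its own class and the classes of u₁, u₂, u₃.
    no-three-neighbours : ∀ {a u₁ u₂ u₃} → Γ a u₁ → Γ a u₂ → Γ a u₃ →
      ¬ u₁ ~ a → ¬ u₂ ~ a → ¬ u₃ ~ a → ¬ u₁ ~ u₂ → ¬ u₁ ~ u₃ → ¬ u₂ ~ u₃ → ⊥
    no-three-neighbours {a} {u₁} {u₂} {u₃} γ₁ γ₂ γ₃ n₁ n₂ n₃ n₁₂ n₁₃ n₂₃ =
      four-splits a h₀ (h u₁) (h u₂) (h u₃) h₀-invariant (h-invariant u₁) (h-invariant u₂) (h-invariant u₃)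
        {y₀ = a} (~-sym (proj₁ (proj₂ other)))
        (λ eq → true≢false (trans (sym (dec-true (a ≟ᶠ a) refl)) (trans eq (dec-false (proj₁ other ≟ᶠ a) (proj₂ (proj₂ other))))))
        (e₁ , off₀ n₁ e₁) (on γ₁ (proj₂ (proj₂ (non u₁))))
        ((e₂ , off₀ n₂ e₂) , off n₁₂ e₂) (on γ₂ (proj₂ (proj₂ (non u₂))))
        (((e₃ , off₀ n₃ e₃) , off n₁₃ e₃) , off n₂₃ e₃) (on γ₃ (proj₂ (proj₂ (non u₃))))
      where
      true≢false : true ≢ false
      true≢false ()
      h₀ : V → Bool
      h₀ u = does (u ≟ᶠ a)
      -- Confined to the class of `c`, so that the functions for different classes do not separate
      -- each other's pairs.
      h : V → V → Bool
      h c u = does (Γ? a u) ∧ (u ~ᵇ c)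
      h₀-invariant : Invariant a h₀
      h₀-invariant {u} {v} g = does-≡ (u ≟ᶠ a) (v ≟ᶠ a)
        (λ { refl → sym (good-fun room₂ g (there (here refl)) (here refl)) })
        (λ { refl → sym (good-inj room₂ g (there (here refl)) (here refl)) })
      h-invariant : ∀ c → Invariant a (h c)
      h-invariant c {u} {v} g = cong₂ _∧_
        (does-≡ (Γ? a u) (Γ? a v) (Γ-invariant g) (Γ-invariant (Equiv.≈-sym (types (a ∷ s)) g)))
        (~ᵇ-congˡ c (forget g))
      non : ∀ u → ∃ λ w → u ~ w × ¬ Γ a w
      non u = let w , w~u , eq = majority-witness a u in
        w , ~-sym w~u , λ γ → proj₂ γ (trans eq (maj-congʳ a (~-sym w~u)))
      -- The vertex `a` deviates from the majority that `u₁` sees in the class of `a`, so some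
      -- vertex following this majority is different from `a`.
      other : ∃ λ a′ → a′ ~ a × a′ ≢ a
      other = let a′ , a′~a , eq = majority-witness u₁ a in
        a′ , a′~a , λ a′≡a → proj₂ (Γ-sym γ₁) (subst (λ v → adj G u₁ v ≡ maj u₁ a) a′≡a eq)
      e₁ : u₁ ~ proj₁ (non u₁)
      e₁ = proj₁ (proj₂ (non u₁))
      e₂ : u₂ ~ proj₁ (non u₂)
      e₂ = proj₁ (proj₂ (non u₂))
      e₃ : u₃ ~ proj₁ (non u₃)
      e₃ = proj₁ (proj₂ (non u₃))
      off₀ : ∀ {u w} → ¬ u ~ a → u ~ w → h₀ u ≡ h₀ w
      off₀ {u} {w} n e = trans (dec-false (u ≟ᶠ a) (λ { refl → n ~-refl })) (sym (dec-false (w ≟ᶠ a) (λ { refl → n e })))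
      off : ∀ {c u w} → ¬ c ~ u → u ~ w → h c u ≡ h c w
      off {c} {u} {w} n e
        rewrite dec-false (u ~? c) (n ∘ ~-sym) | dec-false (w ~? c) (λ w~c → n (~-sym (~-trans e w~c)))
        = trans (∧-zeroʳ _) (sym (∧-zeroʳ _))
      on : ∀ {u w} → Γ a u → ¬ Γ a w → h u u ≢ h u w
      on {u} {w} γ ¬γ eq rewrite dec-true (Γ? a u) γ | dec-false (Γ? a w) ¬γ | dec-true (u ~? u) ~-refl = true≢false eq

    -- Equivalent vertices have Γ-neighbours in the same classes. The three edges can thus be moved
    -- so that they all start at `z`.
    class-degree : ∀ {z a₁ a₂ a₃ u₁ u₂ u₃} → a₁ ~ z → a₂ ~ z → a₃ ~ z → Γ a₁ u₁ → Γ a₂ u₂ → Γ a₃ u₃ →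
      ¬ u₁ ~ z → ¬ u₂ ~ z → ¬ u₃ ~ z → ¬ u₁ ~ u₂ → ¬ u₁ ~ u₃ → ¬ u₂ ~ u₃ → ⊥
    class-degree {z} e₁ e₂ e₃ γ₁ γ₂ γ₃ n₁ n₂ n₃ n₁₂ n₁₃ n₂₃ =
      let v₁ , δ₁ , f₁ = move e₁ γ₁
          v₂ , δ₂ , f₂ = move e₂ γ₂
          v₃ , δ₃ , f₃ = move e₃ γ₃
      in no-three-neighbours δ₁ δ₂ δ₃ (n₁ ∘ ~-trans f₁) (n₂ ∘ ~-trans f₂) (n₃ ∘ ~-trans f₃)
           (λ e → n₁₂ (~-trans f₁ (~-trans e (~-sym f₂)))) (λ e → n₁₃ (~-trans f₁ (~-trans e (~-sym f₃))))
           (λ e → n₂₃ (~-trans f₂ (~-trans e (~-sym f₃))))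
      where
      move : ∀ {a u} → a ~ z → Γ a u → ∃ λ v → Γ z v × u ~ v
      move {u = u} a~z γ = let v , g = push room₂ a~z u in v , Γ-invariant g γ , forget g

  -- Building the isomorphism component by component.

  module Match {G H : ColoredGraph} {K : ℕ} (ge : GameEquivalence G H K)
    (s : List (Fin (n G))) (room : 4 + length (diag s) ≤ K) (d : ℕ)
    (close : ∀ x y → Types._⊢_~_ ge s x y → # (λ z → adj G z x xor adj G z y) ≤ d)
    (stuck : ∀ x → #classes (Types.types ge (x ∷ s)) ≤ 3 + #classes (Types.types ge s))
    (p : List (Fin (n G) × Fin (n H))) (p≡s : map proj₁ p ≡ s)
    (good-p : GameEquivalence.Good ge false p)
    (M : ℕ) (M-bound : (1 + 2 * d) ^ 6 ≤ M) (roomₚ : 3 * M + (3 + length p) ≤ K) where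

    open Types ge
    open Stuck ge s room d close stuck

    U : Set
    U = Fin (n H)

    T : V → U → Set
    T x y = Good false ((x , y) ∷ p)

    T-join : ∀ {x x′ y} → T x y → T x′ y → x ~ x′
    T-join {x} {x′} t t′ = subst (λ l → Good true ((x , x′) ∷ diag l)) p≡s (good-join {false} {p} t t′)

    T-trans : ∀ {x x′ y} → x ~ x′ → T x′ y → T x y
    T-trans {x} {x′} e t = good-trans {false} {p} (subst (λ l → Good true ((x , x′) ∷ diag l)) (sym p≡s) e) t

    roomₚ₃ : 3 + length p ≤ K
    roomₚ₃ = ≤-trans (m≤n+m _ (3 * M)) roomₚ

    roomₚ₂ : 2 + length p ≤ K
    roomₚ₂ = ≤-trans (n≤1+n _) roomₚ₃

    roomₚ₁ : 1 + length p ≤ K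
    roomₚ₁ = ≤-trans (n≤1+n _) roomₚ₂

    -- Transfers the absence of Γ-edges to `H`, where it reads as agreement with `maj`: with `a` and
    -- `b` pebbled, `e` is answered by a vertex in the class of `c`, which is not joined to `a` in
    -- Γ.
    unlinked⇒maj : ∀ {a b c e} → T a b → T c e → b ≢ e → (∀ {c′} → c′ ~ c → ¬ Γ a c′) → adj H b e ≡ maj a c
    unlinked⇒maj {a} {b} {c} {e} tab tce b≢e unlinked with pull roomₚ₂ tab e
    ... | c′ , g = trans (sym (good-adj roomₚ₂ g (there (here refl)) (here refl)))
                     (trans (¬Γ⇒adj≡maj a≢c′ (unlinked c′~c)) (maj-congʳ a c′~c))
      where
      c′~c : c′ ~ c
      c′~c = T-join (good-⊆ roomₚ₁ roomₚ₂ (λ { (here eq) → here eq ; (there e∈) → there (there e∈) }) g) tce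
      a≢c′ : a ≢ c′
      a≢c′ refl = b≢e (good-fun roomₚ₂ g (there (here refl)) (here refl))

    Dom : List (V × U) → V → Set
    Dom φ a = ∃ λ b → (a , b) ∈ φ

    Img : List (V × U) → U → Set
    Img φ b = ∃ λ a → (a , b) ∈ φ

    _≟ᵖ_ : (e e′ : V × U) → Dec (e ≡ e′)
    _≟ᵖ_ = ≡-dec _≟ᶠ_ _≟ᶠ_

    open DecMembership _≟ᵖ_ using (_∈?_)
    open DecMembership (_≟ᶠ_ {n G}) using () renaming (_∈?_ to _∈ⱽ?_)

    dom? : ∀ φ a → Dec (Dom φ a)
    dom? φ a = any? (λ b → (a , b) ∈? φ)

    img? : ∀ φ b → Dec (Img φ b)
    img? φ b = any? (λ a → (a , b) ∈? φ)

    dom-map : ∀ {φ : List (V × U)} {l a} → map proj₁ φ ≡ l → a ∈ l → Dom φ a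
    dom-map {(a , b) ∷ φ} refl (here refl) = b , here refl
    dom-map {e ∷ φ}       refl (there a∈)  = let b , m = dom-map {φ} refl a∈ in b , there m

    dom-map⁻ : ∀ {φ : List (V × U)} {l a b} → map proj₁ φ ≡ l → (a , b) ∈ φ → a ∈ l
    dom-map⁻ refl (here refl) = here refl
    dom-map⁻ {e ∷ φ} refl (there m) = there (dom-map⁻ {φ} refl m)

    -- A partial isomorphism respecting classes pair by pair. Its length is not bounded by `K`, and
    -- the whole list need not be a winning position.
    record Matching (φ : List (V × U)) : Set where
      field
        typed      : ∀ {a b} → (a , b) ∈ φ → T a b
        functional : ∀ {a b b′} → (a , b) ∈ φ → (a , b′) ∈ φ → b ≡ b′
        injective  : ∀ {a a′ b} → (a , b) ∈ φ → (a′ , b) ∈ φ → a ≡ a′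
        adjacency  : ∀ {a b a′ b′} → (a , b) ∈ φ → (a′ , b′) ∈ φ → adj G a a′ ≡ adj H b b′

    -- An isomorphism between unions of components of Γ and of its counterpart on H.
    record Closed (φ : List (V × U)) : Set where
      field
        matching : Matching φ
        closedᴳ  : ∀ {a b a′} → (a , b) ∈ φ → Γ a a′ → Dom φ a′
        closedᴴ  : ∀ {a b a′ b′} → (a , b) ∈ φ → T a′ b′ → ¬ Img φ b′ → adj H b b′ ≡ maj a a′
      open Matching matching public

    good⇒matching : ∀ q {r} → length (q ++ r) ≤ K → (∀ {e} → e ∈ p → e ∈ r) → Good false (q ++ r) → Matching q
    good⇒matching q {r} len p⊆r g = record
      { typed = λ m → good-⊆ roomₚ₁ len (λ { (here refl) → ∈-++⁺ˡ m ; (there e∈) → ∈-++⁺ʳ q (p⊆r e∈) }) g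
      ; functional = λ m m′ → good-fun len g (∈-++⁺ˡ m) (∈-++⁺ˡ m′)
      ; injective = λ m m′ → good-inj len g (∈-++⁺ˡ m) (∈-++⁺ˡ m′)
      ; adjacency = λ m m′ → good-adj len g (∈-++⁺ˡ m) (∈-++⁺ˡ m′) }

    -- A Γ-neighbour of `a` in the class of `a′` would be matched, and `φ` contains with it every
    -- vertex of `H` of its type, among them `b′`. This serves the long components, which are
    -- matched by whole classes.
    classes⇒closedᴴ : ∀ {φ} → Matching φ → (∀ {a b a′} → (a , b) ∈ φ → Γ a a′ → Dom φ a′) →
      (∀ {a b b′} → (a , b) ∈ φ → T a b′ → Img φ b′) →
      ∀ {a b a′ b′} → (a , b) ∈ φ → T a′ b′ → ¬ Img φ b′ → adj H b b′ ≡ maj a a′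
    classes⇒closedᴴ mt closed classᴴ m t b′∉ =
      unlinked⇒maj (Matching.typed mt m) t (λ { refl → b′∉ (_ , m) })
        (λ c~a′ γ → let _ , m′ = closed m γ in b′∉ (classᴴ m′ (T-trans c~a′ t)))

    module Pebbled {q : List (V × U)} (len : length (q ++ p) < K) (g : Good false (q ++ p))
      (closed : ∀ {a b a′} → (a , b) ∈ q → Γ a a′ → Dom q a′) where

      -- The classes of a small component may reach outside of it, so here the whole component stays
      -- on the board. One more pebble answers `b′` by a vertex outside `q`, hence by one not joined
      -- to `a`.
      closedᴴ : ∀ {a b a′ b′} → (a , b) ∈ q → T a′ b′ → ¬ Img q b′ → adj H b b′ ≡ maj a a′
      closedᴴ {a} {b} {a′} {b′} m t b′∉ with pull len g b′
      ... | c , g′ = trans (sym (good-adj len g′ (there (∈-++⁺ˡ m)) (here refl)))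
                       (trans (¬Γ⇒adj≡maj a≢c ¬γ) (maj-congʳ a c~a′))
        where
        unmatched : ∀ {e} → ¬ (c , e) ∈ q
        unmatched m′ = b′∉ (c , subst (λ z → (c , z) ∈ q) (good-fun len g′ (there (∈-++⁺ˡ m′)) (here refl)) m′)
        c~a′ : c ~ a′
        c~a′ = T-join (good-⊆ roomₚ₁ len (λ { (here eq) → here eq ; (there e∈) → there (∈-++⁺ʳ q e∈) }) g′) t
        a≢c : a ≢ c
        a≢c refl = unmatched m
        ¬γ : ¬ Γ a c
        ¬γ γ = unmatched (proj₂ (closed m γ))

      pebbled-closed : Closed q
      pebbled-closed = record
        { matching = good⇒matching q (<⇒≤ len) id g ; closedᴳ = closed ; closedᴴ = closedᴴ }

    -- Sweeping along a path or cycle of classes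

    record ClassCover (u : V) (r q : List (V × U)) : Set where
      field
        good   : Good false (q ++ r)
        small  : length q ≤ M
        inside : ∀ {a b} → (a , b) ∈ q → a ~ u
        cover  : ∀ {a} → u ~ a → Dom q a
        coverᴴ : ∀ {a b b′} → (a , b) ∈ q → T a b′ → Img q b′

    -- Lying in a ball, the class has at most `M` vertices and can be pebbled as a whole. One
    -- further pebble shows that nothing is missed on `H`: a vertex of this type is answered by a
    -- vertex of the class, and that one is already pebbled.
    cover-class : ∀ {u r} → (∀ {e} → e ∈ p → e ∈ r) → M + suc (length r) ≤ K → Good false r →
      (∀ {u′} → u ~ u′ → u′ ∈ ball 6 u) → ∃ λ q → ClassCover u r q
    cover-class {u} {r} p⊆r len g inBall =
      let q , eq , g′ = pebble l (≤-trans (+-mono-≤ l≤M (n≤1+n _)) len) g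
      in q , build q eq g′
      where
      l : List V
      l = filter (_~? u) (ball 6 u)
      l≤M : length l ≤ M
      l≤M = ≤-trans (length-filter (_~? u) (ball 6 u)) (≤-trans (length-ball 6 u) M-bound)
      build : ∀ q → map proj₁ q ≡ l → Good false (q ++ r) → ClassCover u r q
      build q eq g′ = record
        { good = g′ ; small = q≤M ; inside = inside
        ; cover = cover
        ; coverᴴ = λ {a} {b} {b′} m t →
            let c , g″ = pull len′ g′ b′
                c~a = T-join (good-⊆ roomₚ₁ len′ (λ { (here eq) → here eq ; (there e∈) → there (∈-++⁺ʳ q (p⊆r e∈)) }) g″) t
                e , m′ = cover (~-sym (~-trans c~a (inside m)))
            in c , subst (λ z → (c , z) ∈ q) (good-fun len′ g″ (there (∈-++⁺ˡ m′)) (here refl)) m′ }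
        where
        inside : ∀ {a b} → (a , b) ∈ q → a ~ u
        inside m = proj₂ (∈-filter⁻ (_~? u) {xs = ball 6 u} (dom-map⁻ eq m))
        cover : ∀ {a} → u ~ a → Dom q a
        cover u~a = dom-map eq (∈-filter⁺ (_~? u) (inBall u~a) (~-sym u~a))
        q≤M : length q ≤ M
        q≤M = ≤-trans (≤-reflexive (trans (sym (length-map proj₁ q)) (cong length eq))) l≤M
        len′ : length (q ++ r) < K
        len′ = ≤-trans (≤-reflexive (trans (cong suc (length-++ q)) (sym (+-suc _ _)))) (≤-trans (+-monoˡ-≤ _ q≤M) len)

    -- Every class has at most two neighbouring classes.  The classes of z₁ and z₂ are
    -- the only matched ones with unmatched neighbouring classes; only they are pebbled.
    record Sweep (x : V) (φ : List (V × U)) (z₁ z₂ : V) (q₁ q₂ : List (V × U)) : Set where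
      field
        matching : Matching φ
        classᴳ   : ∀ {a b a′} → (a , b) ∈ φ → a ~ a′ → Dom φ a′
        classᴴ   : ∀ {a b b′} → (a , b) ∈ φ → T a b′ → Img φ b′
        reach    : ∀ {a b} → (a , b) ∈ φ → Star Γ x a
        sub₁     : ∀ {e} → e ∈ q₁ → e ∈ φ
        sub₂     : ∀ {e} → e ∈ q₂ → e ∈ φ
        cover₁   : ∀ {a} → z₁ ~ a → Dom q₁ a
        cover₂   : ∀ {a} → z₂ ~ a → Dom q₂ a
        small₁   : length q₁ ≤ M
        small₂   : length q₂ ≤ M
        good₁₂   : Good false (q₁ ++ q₂ ++ p)
        frontier : ∀ {a b u} → (a , b) ∈ φ → Γ a u → ¬ Dom φ u → a ~ z₁ ⊎ a ~ z₂
        -- At the start both ends are the same class, which may still have two unmatched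
        -- neighbouring classes; uniqueness holds once the ends differ.
        single₁  : ¬ z₁ ~ z₂ → ∀ {a a′ u u′} → a ~ z₁ → a′ ~ z₁ → Γ a u → Γ a′ u′ → ¬ Dom φ u → ¬ Dom φ u′ → u ~ u′
        single₂  : ¬ z₁ ~ z₂ → ∀ {a a′ u u′} → a ~ z₂ → a′ ~ z₂ → Γ a u → Γ a′ u′ → ¬ Dom φ u → ¬ Dom φ u′ → u ~ u′
      open Matching matching public

    length-++≤ : ∀ {a b} (q r : List (V × U)) → length q ≤ a → length r ≤ b → length (q ++ r) ≤ a + b
    length-++≤ q r q≤ r≤ = ≤-trans (≤-reflexive (length-++ q)) (+-mono-≤ q≤ r≤)

    -- Room for the two end classes, the class being added, and the spare pebble that `cover-class`
    -- uses on `H`.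
    room-sweep : M + suc (M + (M + length p)) ≤ K
    room-sweep = ≤-trans (≤-reflexive (rearrange M (length p))) (≤-trans (+-monoʳ-≤ (3 * M) (n≤1+n _)) (≤-trans (+-monoʳ-≤ (3 * M) (n≤1+n _)) roomₚ))
      where
      rearrange : ∀ m l → m + suc (m + (m + l)) ≡ 3 * m + suc l
      rearrange = solve-∀

    swap-good : ∀ q₁ q₂ → length q₁ ≤ M → length q₂ ≤ M → Good false (q₁ ++ q₂ ++ p) → Good false (q₂ ++ q₁ ++ p)
    swap-good q₁ q₂ s₁ s₂ = good-⊆ (bound q₂ q₁ s₂ s₁) (bound q₁ q₂ s₁ s₂) sub
      where
      bound : ∀ q q′ → length q ≤ M → length q′ ≤ M → length (q ++ q′ ++ p) ≤ K
      bound q q′ l l′ = ≤-trans (length-++≤ q _ l (length-++≤ q′ p l′ ≤-refl))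
        (≤-trans (≤-trans (n≤1+n _) (m≤n+m _ M)) room-sweep)
      sub : ∀ {e} → e ∈ q₂ ++ q₁ ++ p → e ∈ q₁ ++ q₂ ++ p
      sub e∈ with ∈-++⁻ q₂ e∈
      ... | inj₁ e∈q₂ = ∈-++⁺ʳ q₁ (∈-++⁺ˡ e∈q₂)
      ... | inj₂ e∈′ with ∈-++⁻ q₁ e∈′
      ...   | inj₁ e∈q₁ = ∈-++⁺ˡ e∈q₁
      ...   | inj₂ e∈p  = ∈-++⁺ʳ q₁ (∈-++⁺ʳ q₂ e∈p)

    swap-sweep : ∀ {x φ z₁ z₂ q₁ q₂} → Sweep x φ z₁ z₂ q₁ q₂ → Sweep x φ z₂ z₁ q₂ q₁
    swap-sweep {q₁ = q₁} {q₂} S = record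
      { matching = matching ; classᴳ = classᴳ ; classᴴ = classᴴ ; reach = reach
      ; sub₁ = sub₂ ; sub₂ = sub₁ ; cover₁ = cover₂ ; cover₂ = cover₁ ; small₁ = small₂ ; small₂ = small₁
      ; good₁₂ = swap-good q₁ q₂ small₁ small₂ good₁₂
      ; frontier = λ m γ u∉ → Data.Sum.swap (frontier m γ u∉)
      ; single₁ = λ ne → single₂ (ne ∘ ~-sym) ; single₂ = λ ne → single₁ (ne ∘ ~-sym) }
      where open Sweep S

    module SweepStep {x φ z₁ z₂ q₁ q₂} (S : Sweep x φ z₁ z₂ q₁ q₂) (z₂∈ : Dom φ z₂)
      {a b u} (a∈ : (a , b) ∈ φ) (γ : Γ a u) (u∉ : ¬ Dom φ u) (a~z₁ : a ~ z₁)
      {q} (C : ClassCover u (q₁ ++ q₂ ++ p) q) where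

      open Sweep S
      open ClassCover C

      private
        len : length (q ++ q₁ ++ q₂ ++ p) ≤ K
        len = ≤-trans (length-++≤ q _ small (length-++≤ q₁ _ small₁ (length-++≤ q₂ p small₂ ≤-refl)))
          (≤-trans (+-monoʳ-≤ M (n≤1+n _)) room-sweep)

        mq : Matching q
        mq = good⇒matching q len (λ e∈ → ∈-++⁺ʳ q₁ (∈-++⁺ʳ q₂ e∈)) good

        module Q = Matching mq

        fresh : ∀ {c a′ b′} → c ~ u → (a′ , b′) ∈ φ → ¬ a′ ~ c
        fresh c~u m a′~c = u∉ (classᴳ m (~-trans a′~c c~u))

        no-clash : ∀ {c e a′ b′} → (c , e) ∈ q → (a′ , b′) ∈ φ → e ≢ b′
        no-clash m m′ refl = fresh (inside m) m′ (T-join (typed m′) (Q.typed m))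

        -- If `a′` lies in an end class, it is on the board together with `c`. Otherwise `a′` has no
        -- unmatched Γ-neighbour, and both adjacencies are given by the same majority.
        cross : ∀ {c e a′ b′} → (c , e) ∈ q → (a′ , b′) ∈ φ → adj G a′ c ≡ adj H b′ e
        cross {c} {e} {a′} {b′} m m′ with a′ ~? z₁ | a′ ~? z₂
        ... | yes a′~z₁ | _ = let b″ , m″ = cover₁ (~-sym a′~z₁) in
                subst (λ z → adj G a′ c ≡ adj H z e) (functional (sub₁ m″) m′)
                  (good-adj len good (∈-++⁺ʳ q (∈-++⁺ˡ m″)) (∈-++⁺ˡ m))
        ... | no _ | yes a′~z₂ = let b″ , m″ = cover₂ (~-sym a′~z₂) in
                subst (λ z → adj G a′ c ≡ adj H z e) (functional (sub₂ m″) m′)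
                  (good-adj len good (∈-++⁺ʳ q (∈-++⁺ʳ q₁ (∈-++⁺ˡ m″))) (∈-++⁺ˡ m))
        ... | no n₁ | no n₂ =
                trans (¬Γ⇒adj≡maj (λ { refl → fresh (inside m) m′ ~-refl }) (unlinked ~-refl))
                      (sym (unlinked⇒maj (typed m′) (Q.typed m) (≢-sym (no-clash m m′)) unlinked))
          where
          unlinked : ∀ {c′} → c′ ~ c → ¬ Γ a′ c′
          unlinked c′~c γ′ with frontier m′ γ′ (λ (_ , m″) → fresh (~-trans c′~c (inside m)) m″ ~-refl)
          ... | inj₁ e = n₁ e
          ... | inj₂ e = n₂ e

        φ′ : List (V × U)
        φ′ = q ++ φ

        Dom-φ : ∀ {v} → Dom φ v → Dom φ′ v
        Dom-φ (b , m) = b , ∈-++⁺ʳ q m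

        Dom-u : ∀ {v} → v ~ u → Dom φ′ v
        Dom-u v~u = let b , m = cover (~-sym v~u) in b , ∈-++⁺ˡ m

        matching′ : Matching φ′
        matching′ = record
          { typed = λ m → case₁ (∈-++⁻ q m)
          ; functional = λ m m′ → case₂ (∈-++⁻ q m) (∈-++⁻ q m′)
          ; injective = λ m m′ → case₃ (∈-++⁻ q m) (∈-++⁻ q m′)
          ; adjacency = λ m m′ → case₄ (∈-++⁻ q m) (∈-++⁻ q m′) }
          where
          case₁ : ∀ {c e} → (c , e) ∈ q ⊎ (c , e) ∈ φ → T c e
          case₁ (inj₁ m) = Q.typed m
          case₁ (inj₂ m) = typed m
          case₂ : ∀ {c e e′} → (c , e) ∈ q ⊎ (c , e) ∈ φ → (c , e′) ∈ q ⊎ (c , e′) ∈ φ → e ≡ e′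
          case₂ (inj₁ m) (inj₁ m′) = Q.functional m m′
          case₂ (inj₁ m) (inj₂ m′) = contradiction ~-refl (fresh (inside m) m′)
          case₂ (inj₂ m) (inj₁ m′) = contradiction ~-refl (fresh (inside m′) m)
          case₂ (inj₂ m) (inj₂ m′) = functional m m′
          case₃ : ∀ {c c′ e} → (c , e) ∈ q ⊎ (c , e) ∈ φ → (c′ , e) ∈ q ⊎ (c′ , e) ∈ φ → c ≡ c′
          case₃ (inj₁ m) (inj₁ m′) = Q.injective m m′
          case₃ (inj₁ m) (inj₂ m′) = contradiction refl (no-clash m m′)
          case₃ (inj₂ m) (inj₁ m′) = contradiction refl (no-clash m′ m)
          case₃ (inj₂ m) (inj₂ m′) = injective m m′
          case₄ : ∀ {c e c′ e′} → (c , e) ∈ q ⊎ (c , e) ∈ φ → (c′ , e′) ∈ q ⊎ (c′ , e′) ∈ φ → adj G c c′ ≡ adj H e e′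
          case₄ (inj₁ m) (inj₁ m′) = Q.adjacency m m′
          case₄ (inj₁ m) (inj₂ m′) = trans (adj-sym G _ _) (trans (cross m m′) (adj-sym H _ _))
          case₄ (inj₂ m) (inj₁ m′) = cross m′ m
          case₄ (inj₂ m) (inj₂ m′) = adjacency m m′

        -- The class of `a` already neighbours that of `u`; two different unmatched neighbouring
        -- classes would make three.
        single₁′ : ∀ {c c′ w w′} → c ~ u → c′ ~ u → Γ c w → Γ c′ w′ → ¬ Dom φ′ w → ¬ Dom φ′ w′ → w ~ w′
        single₁′ {w = w} {w′} c~u c′~u γ₁ γ₂ w∉ w′∉ = decidable-stable (w ~? w′) λ ne →
          class-degree c~u c′~u ~-refl γ₁ γ₂ (Γ-sym γ) (w∉ ∘ Dom-u) (w′∉ ∘ Dom-u) (fresh ~-refl a∈) ne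
            (λ e → w∉ (Dom-φ (classᴳ a∈ (~-sym e)))) (λ e → w′∉ (Dom-φ (classᴳ a∈ (~-sym e))))

        single₂′ : ∀ {c c′ w w′} → c ~ z₂ → c′ ~ z₂ → Γ c w → Γ c′ w′ → ¬ Dom φ′ w → ¬ Dom φ′ w′ → w ~ w′
        single₂′ {w = w} {w′} c~z₂ c′~z₂ γ₁ γ₂ w∉ w′∉ with z₁ ~? z₂
        ... | no  ne = single₂ ne c~z₂ c′~z₂ γ₁ γ₂ (w∉ ∘ Dom-φ) (w′∉ ∘ Dom-φ)
        ... | yes z₁~z₂ = decidable-stable (w ~? w′) λ ne →
          class-degree c~z₂ c′~z₂ (~-trans a~z₁ z₁~z₂) γ₁ γ₂ γ
            (λ e → w∉ (Dom-φ (classᴳ (proj₂ z₂∈) (~-sym e)))) (λ e → w′∉ (Dom-φ (classᴳ (proj₂ z₂∈) (~-sym e))))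
            (λ e → u∉ (classᴳ (proj₂ z₂∈) (~-sym e))) ne (w∉ ∘ Dom-u) (w′∉ ∘ Dom-u)

        -- If the ends differ, the class of `u` was the only unmatched neighbour of the class of
        -- `z₁`, which can now leave the board. If they coincide, this class remains on the board as
        -- that of `z₂`.
        frontier′ : ∀ {c e w} → (c , e) ∈ φ′ → Γ c w → ¬ Dom φ′ w → c ~ u ⊎ c ~ z₂
        frontier′ m γ′ w∉ with ∈-++⁻ q m
        ... | inj₁ m′ = inj₁ (inside m′)
        ... | inj₂ m′ with frontier m′ γ′ (w∉ ∘ Dom-φ)
        ...   | inj₂ c~z₂ = inj₂ c~z₂
        ...   | inj₁ c~z₁ with z₁ ~? z₂
        ...     | yes z₁~z₂ = inj₂ (~-trans c~z₁ z₁~z₂)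
        ...     | no  ne = contradiction (Dom-u (single₁ ne c~z₁ a~z₁ γ′ γ (w∉ ∘ Dom-φ) u∉)) w∉

        classᴳ′ : ∀ {c e c′} → (c , e) ∈ φ′ → c ~ c′ → Dom φ′ c′
        classᴳ′ m c~c′ with ∈-++⁻ q m
        ... | inj₁ m′ = Dom-u (~-trans (~-sym c~c′) (inside m′))
        ... | inj₂ m′ = Dom-φ (classᴳ m′ c~c′)

        classᴴ′ : ∀ {c e e′} → (c , e) ∈ φ′ → T c e′ → Img φ′ e′
        classᴴ′ m t with ∈-++⁻ q m
        ... | inj₁ m′ = let c , m″ = coverᴴ m′ t in c , ∈-++⁺ˡ m″
        ... | inj₂ m′ = let c , m″ = classᴴ m′ t in c , ∈-++⁺ʳ q m″

      next : (∀ {u′} → u ~ u′ → u′ ∈ ball 6 u) → Sweep x φ′ u z₂ q q₂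
      next inBall = record
        { matching = matching′ ; classᴳ = classᴳ′ ; classᴴ = classᴴ′
        ; reach = λ m → reach′ (∈-++⁻ q m)
        ; sub₁ = ∈-++⁺ˡ ; sub₂ = ∈-++⁺ʳ q ∘ sub₂ ; cover₁ = cover ; cover₂ = cover₂
        ; small₁ = small ; small₂ = small₂
        ; good₁₂ = good-⊆ (≤-trans (length-++≤ q _ small (length-++≤ q₂ p small₂ ≤-refl))
                             (≤-trans (≤-trans (n≤1+n _) (m≤n+m _ M)) room-sweep)) len keep good
        ; frontier = frontier′ ; single₁ = λ _ → single₁′ ; single₂ = λ _ → single₂′ }
        where
        reach′ : ∀ {c e} → (c , e) ∈ q ⊎ (c , e) ∈ φ → Star Γ x c
        reach′ (inj₁ m) = reach a∈ ◅◅ (γ ◅ ball⇒Star 6 (inBall (~-sym (inside m))))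
        reach′ (inj₂ m) = reach m
        keep : ∀ {e} → e ∈ q ++ q₂ ++ p → e ∈ q ++ q₁ ++ q₂ ++ p
        keep e∈ with ∈-++⁻ q e∈
        ... | inj₁ e∈q = ∈-++⁺ˡ e∈q
        ... | inj₂ e∈r = ∈-++⁺ʳ q (∈-++⁺ʳ q₁ e∈r)

      grows : Dom φ′ u
      grows = Dom-u ~-refl

    unmatched : List (V × U) → ℕ
    unmatched φ = length (filter (λ v → ¬? (dom? φ v)) (allFin (n G)))

    unmatched-< : ∀ q φ {u} → ¬ Dom φ u → Dom (q ++ φ) u → unmatched (q ++ φ) < unmatched φ
    unmatched-< q φ {u} u∉ u∈ = length-filter-< _ _ (λ ne (b , m) → ne (b , ∈-++⁺ʳ q m)) (∈-allFin u) u∉ (λ ne → ne u∈)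

    record Component (x : V) (y : U) (φ : List (V × U)) : Set where
      field
        closed  : Closed φ
        start   : (x , y) ∈ φ
        reach   : ∀ {a b} → (a , b) ∈ φ → Star Γ x a

    sweep : ∀ {x y} → (∀ {z} → Star Γ x z → ∀ {z′} → z ~ z′ → z′ ∈ ball 6 z) →
      ∀ m {φ z₁ z₂ q₁ q₂} → Sweep x φ z₁ z₂ q₁ q₂ → Dom φ z₁ → Dom φ z₂ → (x , y) ∈ φ → unmatched φ ≤ m →
      ∃ (Component x y)
    sweep {x} {y} inBall m {φ} {z₁} {z₂} S z₁∈ z₂∈ xy∈ bound
      with any? (λ a → any? (λ u → dom? φ a ×-dec ¬? (dom? φ u) ×-dec Γ? a u))
    ... | no none = φ , record
      { closed = record { matching = Sweep.matching S ; closedᴳ = closed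
                        ; closedᴴ = classes⇒closedᴴ (Sweep.matching S) closed (Sweep.classᴴ S) }
      ; start = xy∈ ; reach = Sweep.reach S }
      where
      closed : ∀ {a b a′} → (a , b) ∈ φ → Γ a a′ → Dom φ a′
      closed {a} {b} {a′} m γ = decidable-stable (dom? φ a′) (λ a′∉ → none (a , a′ , (b , m) , a′∉ , γ))
    ... | yes (a , u , (b , a∈) , u∉ , γ) = continue (Sweep.frontier S a∈ γ u∉)
      where
      advance : ∀ m → unmatched φ ≤ m → ∀ {z₁ z₂ q₁ q₂} → Sweep x φ z₁ z₂ q₁ q₂ → Dom φ z₂ → a ~ z₁ → ∃ (Component x y)
      continue : a ~ z₁ ⊎ a ~ z₂ → ∃ (Component x y)
      continue (inj₁ a~z₁) = advance m bound S z₂∈ a~z₁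
      continue (inj₂ a~z₂) = advance m bound (swap-sweep S) z₁∈ a~z₂
      -- The pair of `u` and `b` is not a step of the sweep; it only witnesses that `u` still counts
      -- as unmatched, so the bound cannot be zero.
      advance zero bound′ S′ z∈ a~z =
        contradiction (≤-trans (unmatched-< ((u , b) ∷ []) φ u∉ (b , here refl)) bound′) λ ()
      advance (suc m) bound′ {q₁ = q₁} {q₂} S′ z∈ a~z =
        let inBallᵤ = inBall (Sweep.reach S a∈ ◅◅ (γ ◅ ε))
            q , C = cover-class (λ e∈ → ∈-++⁺ʳ q₁ (∈-++⁺ʳ q₂ e∈))
                      (≤-trans (+-monoʳ-≤ M (s≤s (length-++≤ q₁ _ (Sweep.small₁ S′) (length-++≤ q₂ p (Sweep.small₂ S′) ≤-refl)))) room-sweep)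
                      (Sweep.good₁₂ S′) inBallᵤ
            open SweepStep S′ z∈ a∈ γ u∉ a~z C
        in sweep inBall m (next inBallᵤ) grows (let b′ , m′ = z∈ in b′ , ∈-++⁺ʳ q m′) (∈-++⁺ʳ q xy∈)
             (≤-pred (≤-trans (unmatched-< q φ u∉ grows) bound′))

    ball-closed : ∀ {j z w u} → (∀ {w u} → w ∈ ball j z → Γ w u → u ∈ ball j z) → w ∈ ball j z → Star Γ w u → u ∈ ball j z
    ball-closed closed w∈ ε        = w∈
    ball-closed {j} {z} closed w∈ (γ ◅ γs) = ball-closed {j} {z} closed (closed w∈ γ) γs

    saturated? : ∀ j z → (∀ {w u} → w ∈ ball j z → Γ w u → u ∈ ball j z) ⊎ ∃ λ y → y ∈ ball (suc j) z × y ∉ ball j z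
    saturated? j z with any? (λ y → (y ∈ⱽ? ball (suc j) z) ×-dec ¬? (y ∈ⱽ? ball j z))
    ... | yes found = inj₂ found
    ... | no  none  = inj₁ λ {_} {u} w∈ γ → decidable-stable (u ∈ⱽ? ball j z) (λ u∉ → none (u , ball-step {j} {z} w∈ γ , u∉))

    -- The radius 4 is twice 2: if the ball of radius 2 about some `z` of the component were closed
    -- under Γ, any two vertices of the component would be at distance at most 4. So if the ball of
    -- radius 4 about `x` is not closed, every `z` in the component has a vertex at distance exactly
    -- 3, and `class-in-ball` applies throughout.
    component : ∀ {x y} → T x y → ∃ (Component x y)
    component {x} {y} txy with saturated? 4 x
    ... | inj₁ saturated =
      let r , eq , g = pebble (ball 4 x) (≤-trans (+-monoˡ-≤ _ size₄) roomM) txy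
      in r ++ (x , y) ∷ [] , small r eq g
      where
      size₄ : length (ball 4 x) ≤ M
      size₄ = ≤-trans (length-ball 4 x) (≤-trans (^-monoʳ-≤ (1 + 2 * d) {4} {6} (m≤m+n 4 2)) M-bound)
      roomM : M + suc (length p) ≤ K
      roomM = ≤-trans (+-monoʳ-≤ M (s≤s (≤-trans (m≤n+m _ M) (m≤n+m _ M)))) room-sweep
      small : ∀ r → map proj₁ r ≡ ball 4 x → Good false (r ++ (x , y) ∷ p) → Component x y (r ++ (x , y) ∷ [])
      small r eq g = record
        { closed = Pebbled.pebbled-closed {q} len (subst (Good false) (sym (++-assoc r ((x , y) ∷ []) p)) g)
            (λ m γ → let b , m′ = dom-map eq (saturated (inside m) γ) in b , ∈-++⁺ˡ m′)
        ; start = ∈-++⁺ʳ r (here refl)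
        ; reach = λ m → ball⇒Star 4 (inside m) }
        where
        q : List (V × U)
        q = r ++ (x , y) ∷ []
        inside : ∀ {a b} → (a , b) ∈ q → a ∈ ball 4 x
        inside m with ∈-++⁻ r m
        ... | inj₁ m′ = dom-map⁻ eq m′
        ... | inj₂ (here refl) = ball-mono {0} {4} {x} z≤n (here refl)
        rearrange : ∀ m l → 1 + (m + 1 + l) ≡ m + (2 + l)
        rearrange = solve-∀
        len : length (q ++ p) < K
        len = ≤-trans (s≤s (length-++≤ q p (length-++≤ r _ (≤-trans (≤-reflexive (trans (sym (length-map proj₁ r)) (cong length eq))) size₄) ≤-refl) ≤-refl))
          (≤-trans (≤-reflexive (rearrange M (length p))) (≤-trans (+-mono-≤ (m≤m+n M _) (n≤1+n _)) roomₚ))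
    ... | inj₂ (y₀ , y₀∈ , y₀∉) =
      let q , C = cover-class there (≤-trans (+-monoʳ-≤ M (n≤1+n _)) (≤-trans (+-monoˡ-≤ _ (m≤m+n M _)) roomₚ)) txy (inBall ε)
      in begin-sweep q C
      where
      inBall : ∀ {z} → Star Γ x z → ∀ {z′} → z ~ z′ → z′ ∈ ball 6 z
      inBall {z} xz with saturated? 2 z
      ... | inj₂ outside = class-in-ball z outside
      ... | inj₁ saturated = contradiction (ball-trans {2} {x} 2 (ball-sym 2 x∈)
                               (ball-closed {2} {z} saturated x∈ (ball⇒Star 5 y₀∈))) y₀∉
        where
        x∈ : x ∈ ball 2 z
        x∈ = ball-closed {2} {z} saturated (ball-mono {0} {2} {z} z≤n (here refl)) (reverse Γ-sym xz)
      begin-sweep : ∀ q → ClassCover x ((x , y) ∷ p) q → ∃ (Component x y)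
      begin-sweep q C = sweep inBall (unmatched q) S x∈ x∈ xy∈ ≤-refl
        where
        open ClassCover C
        len : length (q ++ (x , y) ∷ p) ≤ K
        len = ≤-trans (length-++≤ q _ small ≤-refl) (≤-trans (+-monoʳ-≤ M (s≤s (≤-trans (m≤n+m _ M) (m≤n+m _ M)))) room-sweep)
        x∈ : Dom q x
        x∈ = cover ~-refl
        xy∈ : (x , y) ∈ q
        xy∈ = subst (λ z → (x , z) ∈ q) (good-fun len good (∈-++⁺ˡ (proj₂ x∈)) (∈-++⁺ʳ q (here refl))) (proj₂ x∈)
        double : ∀ {e} → e ∈ q ++ q ++ p → e ∈ q ++ (x , y) ∷ p
        double e∈ with ∈-++⁻ q e∈
        ... | inj₁ e∈q = ∈-++⁺ˡ e∈q
        ... | inj₂ e∈′ with ∈-++⁻ q e∈′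
        ...   | inj₁ e∈q = ∈-++⁺ˡ e∈q
        ...   | inj₂ e∈p = ∈-++⁺ʳ q (there e∈p)
        S : Sweep x q x x q q
        S = record
          { matching = good⇒matching q len there good
          ; classᴳ = λ m e → cover (~-sym (~-trans (~-sym e) (inside m)))
          ; classᴴ = coverᴴ
          ; reach = λ m → ball⇒Star 6 (inBall ε (~-sym (inside m)))
          ; sub₁ = id ; sub₂ = id ; cover₁ = cover ; cover₂ = cover ; small₁ = small ; small₂ = small
          ; good₁₂ = good-⊆ (≤-trans (length-++≤ q _ small (length-++≤ q p small ≤-refl))
                        (≤-trans (≤-trans (n≤1+n _) (m≤n+m _ M)) room-sweep)) len double good
          ; frontier = λ m _ _ → inj₁ (inside m)
          ; single₁ = λ ne → contradiction ~-refl ne ; single₂ = λ ne → contradiction ~-refl ne }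

    -- Gluing components

    glue : ∀ {φ ψ x y} → Closed φ → Component x y ψ → ¬ Dom φ x → ¬ Img φ y → Closed (ψ ++ φ)
    glue {φ} {ψ} {x} {y} F comp x∉ y∉ = record
      { matching = record
        { typed = λ m → case₁ (∈-++⁻ ψ m)
        ; functional = λ m m′ → case₂ (∈-++⁻ ψ m) (∈-++⁻ ψ m′)
        ; injective = λ m m′ → case₃ (∈-++⁻ ψ m) (∈-++⁻ ψ m′)
        ; adjacency = λ m m′ → case₄ (∈-++⁻ ψ m) (∈-++⁻ ψ m′) }
      ; closedᴳ = λ m γ → case₅ (∈-++⁻ ψ m) γ
      ; closedᴴ = λ m t ∉ → case₆ (∈-++⁻ ψ m) t ∉ }
      where
      module F = Closed F
      module P = Closed (Component.closed comp)
      back : ∀ {c e} → (c , e) ∈ ψ → Star Γ c x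
      back m = reverse Γ-sym (Component.reach comp m)
      walkᴳ : ∀ {c} → Star Γ c x → Dom φ c → Dom φ x
      walkᴳ ε        c∈      = c∈
      walkᴳ (γ ◅ γs) (b , m) = walkᴳ γs (F.closedᴳ m γ)
      -- The first Γ-edge whose image leaves `Img φ` would agree with the majority by `F.closedᴴ`,
      -- and hence, since `ψ` preserves adjacency, would be no Γ-edge. So the image of the path
      -- stays in `Img φ` as far as `y`.
      walkᴴ : ∀ {c e} → Star Γ c x → (c , e) ∈ ψ → Img φ e → Img φ y
      walkᴴ ε m e∈ = subst (Img φ) (P.functional m (Component.start comp)) e∈
      walkᴴ {c} {e} (_◅_ {j = c′} γ γs) m (a , m′) =
        let e′ , m″ = P.closedᴳ m γ
            e′∈ = decidable-stable (img? φ e′) λ e′∉ → proj₂ γ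
                    (trans (P.adjacency m m″) (trans (F.closedᴴ m′ (P.typed m″) e′∉)
                      (maj-congˡ c′ (T-join (F.typed m′) (P.typed m)))))
        in walkᴴ γs m″ e′∈
      freshᴳ : ∀ {c e} → (c , e) ∈ ψ → ¬ Dom φ c
      freshᴳ m c∈ = x∉ (walkᴳ (back m) c∈)
      freshᴴ : ∀ {c e} → (c , e) ∈ ψ → ¬ Img φ e
      freshᴴ m e∈ = y∉ (walkᴴ (back m) m e∈)
      cross : ∀ {a b c e} → (a , b) ∈ φ → (c , e) ∈ ψ → adj G a c ≡ adj H b e
      cross m m′ = trans (¬Γ⇒adj≡maj (λ { refl → freshᴳ m′ (_ , m) }) (λ γ → freshᴳ m′ (F.closedᴳ m γ)))
                         (sym (F.closedᴴ m (P.typed m′) (freshᴴ m′)))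
      case₁ : ∀ {c e} → (c , e) ∈ ψ ⊎ (c , e) ∈ φ → T c e
      case₁ (inj₁ m) = P.typed m
      case₁ (inj₂ m) = F.typed m
      case₂ : ∀ {c e e′} → (c , e) ∈ ψ ⊎ (c , e) ∈ φ → (c , e′) ∈ ψ ⊎ (c , e′) ∈ φ → e ≡ e′
      case₂ (inj₁ m) (inj₁ m′) = P.functional m m′
      case₂ (inj₁ m) (inj₂ m′) = contradiction (_ , m′) (freshᴳ m)
      case₂ (inj₂ m) (inj₁ m′) = contradiction (_ , m) (freshᴳ m′)
      case₂ (inj₂ m) (inj₂ m′) = F.functional m m′
      case₃ : ∀ {c c′ e} → (c , e) ∈ ψ ⊎ (c , e) ∈ φ → (c′ , e) ∈ ψ ⊎ (c′ , e) ∈ φ → c ≡ c′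
      case₃ (inj₁ m) (inj₁ m′) = P.injective m m′
      case₃ (inj₁ m) (inj₂ m′) = contradiction (_ , m′) (freshᴴ m)
      case₃ (inj₂ m) (inj₁ m′) = contradiction (_ , m) (freshᴴ m′)
      case₃ (inj₂ m) (inj₂ m′) = F.injective m m′
      case₄ : ∀ {c e c′ e′} → (c , e) ∈ ψ ⊎ (c , e) ∈ φ → (c′ , e′) ∈ ψ ⊎ (c′ , e′) ∈ φ → adj G c c′ ≡ adj H e e′
      case₄ (inj₁ m) (inj₁ m′) = P.adjacency m m′
      case₄ (inj₁ m) (inj₂ m′) = trans (adj-sym G _ _) (trans (cross m′ m) (adj-sym H _ _))
      case₄ (inj₂ m) (inj₁ m′) = cross m m′
      case₄ (inj₂ m) (inj₂ m′) = F.adjacency m m′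
      case₅ : ∀ {a b a′} → (a , b) ∈ ψ ⊎ (a , b) ∈ φ → Γ a a′ → Dom (ψ ++ φ) a′
      case₅ (inj₁ m) γ = let b , m′ = P.closedᴳ m γ in b , ∈-++⁺ˡ m′
      case₅ (inj₂ m) γ = let b , m′ = F.closedᴳ m γ in b , ∈-++⁺ʳ ψ m′
      case₆ : ∀ {a b a′ b′} → (a , b) ∈ ψ ⊎ (a , b) ∈ φ → T a′ b′ → ¬ Img (ψ ++ φ) b′ → adj H b b′ ≡ maj a a′
      case₆ (inj₁ m) t ∉ = P.closedᴴ m t (λ (a , m′) → ∉ (a , ∈-++⁺ˡ m′))
      case₆ (inj₂ m) t ∉ = F.closedᴴ m t (λ (a , m′) → ∉ (a , ∈-++⁺ʳ ψ m′))

    private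
      matchOne : Σ (V ↔ U) λ f → ∀ x → T x (to f x)
      matchOne = good-ext roomₚ₁ good-p

      f : V → U
      f = to (proj₁ matchOne)

      f-typed : ∀ x → T x (f x)
      f-typed = proj₂ matchOne

      f-injective : ∀ {a a′} → f a ≡ f a′ → a ≡ a′
      f-injective {a} {a′} eq = trans (sym (strictlyInverseʳ (proj₁ matchOne) a))
        (trans (cong (from (proj₁ matchOne)) eq) (strictlyInverseʳ (proj₁ matchOne) a′))

    no-injection : ∀ {l : List V} {x} (_≋_ : V → V → Set) → AllPairs _≢_ l → (x∈ : x ∈ l) →
      (∀ {a a′ c} → a ≋ c → a′ ≋ c → a ≡ a′) → (∀ {a} → a ∈ l → ∃ λ c → a ≋ c × c ∈ l × c ≢ x) → ⊥
    no-injection {l} {x} _≋_ unique x∈ inj total =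
      <⇒≱ (≤-reflexive (sym (length-removeAt′ l (index x∈))))
        (length-≤-apart _≋_ _≢_ (λ e e′ ne → ne (inj e e′)) unique
          (All.tabulate (λ a∈ → let c , a≋c , c∈ , c≢x = total a∈ in
             Any.map (λ { refl → a≋c }) (any-remove {A = V} x∈ (λ { refl → c≢x }) c∈))))

    unique-allFin : ∀ m → AllPairs _≢_ (allFin m)
    unique-allFin m = Unique.allFin⁺ m
  
    -- Otherwise `f` followed by the inverse of `φ` would map the class of `x` injectively into
    -- itself and miss `x`.
    free-partner : ∀ {φ x} → Matching φ → ¬ Dom φ x → ∃ λ y → T x y × ¬ Img φ y
    free-partner {φ} {x} mt x∉ with any? (λ y → good? false ((x , y) ∷ p) ×-dec ¬? (img? φ y))
    ... | yes found = found
    ... | no  none  = ⊥-elim (no-injection {filter (_~? x) (allFin (n G))} {x} (λ a c → (c , f a) ∈ φ)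
            (AllPairs.filter⁺ (_~? x) (unique-allFin (n G))) (∈-filter⁺ (_~? x) (∈-allFin x) ~-refl)
            (λ m m′ → f-injective (functional m m′)) total)
      where
      open Matching mt
      total : ∀ {a} → a ∈ filter (_~? x) (allFin (n G)) → ∃ λ c → (c , f a) ∈ φ × c ∈ filter (_~? x) (allFin (n G)) × c ≢ x
      total {a} a∈ =
        let a~x = proj₂ (∈-filter⁻ (_~? x) {xs = allFin (n G)} a∈)
            c , m = decidable-stable (img? φ (f a)) (λ fa∉ → none (f a , T-trans (~-sym a~x) (f-typed a) , fa∉))
        in c , m , ∈-filter⁺ (_~? x) (∈-allFin c) (~-trans (T-join (typed m) (f-typed a)) a~x) ,
           λ c≡x → x∉ (f a , subst (λ z → (z , f a) ∈ φ) c≡x m)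

    total-matching : ∀ l → ∃ λ φ → Closed φ × (∀ {a} → a ∈ l → Dom φ a)
    total-matching [] = [] , record { matching = record { typed = λ () ; functional = λ () ; injective = λ () ; adjacency = λ () }
                                    ; closedᴳ = λ () ; closedᴴ = λ () } , λ ()
    total-matching (x ∷ l) with total-matching l
    ... | φ , F , total with dom? φ x
    ...   | yes x∈ = φ , F , λ { (here refl) → x∈ ; (there a∈) → total a∈ }
    ...   | no  x∉ =
      let y , txy , y∉ = free-partner (Closed.matching F) x∉
          ψ , comp = component txy
      in ψ ++ φ , glue F comp x∉ y∉ ,
         λ { (here refl) → y , ∈-++⁺ˡ (Component.start comp) ; (there a∈) → let b , m = total a∈ in b , ∈-++⁺ʳ ψ m }

    isomorphism : Iso G H
    isomorphism = mk↔ₛ′ g g⁻¹ (λ y → functional (gm (g⁻¹ y)) (proj₂ (onto y))) (λ x → injective (proj₂ (onto (g x))) (gm x)) ,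
        (λ x y → adjacency (gm x) (gm y)) , (λ x → good-col roomₚ₁ (typed (gm x)) (here refl))
      where
      φ : List (V × U)
      φ = proj₁ (total-matching (allFin (n G)))
      open Closed (proj₁ (proj₂ (total-matching (allFin (n G)))))
      g : V → U
      g x = proj₁ (proj₂ (proj₂ (total-matching (allFin (n G)))) (∈-allFin x))
      gm : ∀ x → (x , g x) ∈ φ
      gm x = proj₂ (proj₂ (proj₂ (total-matching (allFin (n G)))) (∈-allFin x))
      onto : ∀ y → Img φ y
      -- Counting again: if `y` were missed, the matching followed by `f⁻¹` would be an injection of
      -- the vertices of `G` into themselves that misses `f⁻¹ y`.
      onto y = decidable-stable (img? φ y) λ y∉ →
        no-injection {allFin (n G)} {f⁻¹ y} (λ a c → f c ≡ g a) (unique-allFin (n G)) (∈-allFin _)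
          (λ {a} {a′} e e′ → injective (gm a) (subst (λ z → (a′ , z) ∈ φ) (trans (sym e′) e) (gm a′)))
          (λ {a} _ → f⁻¹ (g a) , f-f⁻¹ (g a) , ∈-allFin _ ,
             λ eq → y∉ (a , subst (λ z → (a , z) ∈ φ) (trans (sym (f-f⁻¹ (g a))) (trans (cong f eq) (f-f⁻¹ y))) (gm a)))
        where
        f⁻¹ : U → V
        f⁻¹ = from (proj₁ matchOne)
        f-f⁻¹ : ∀ y → f (f⁻¹ y) ≡ y
        f-f⁻¹ = strictlyInverseˡ (proj₁ matchOne)
      g⁻¹ : U → V
      g⁻¹ y = proj₁ (onto y)

-- Integer roots and the sublinear error term.

module Asymptotics where

  open import Data.Nat using (_+_; _*_; _^_; _/_)
  open import Data.Integer using (+_; -[1+_]; +≤+)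
  import Data.Integer as ℤ
  import Data.Integer.Properties as ℤ
  open import Data.Rational using (ℚ; mkℚ; 0ℚ; ∣_∣; toℚᵘ; positive) renaming (_≤_ to _≤ℚ_; _<_ to _<ℚ_; _/_ to _/ℚ_; _+_ to _+ℚ_; _*_ to _*ℚ_)
  import Data.Rational.Properties as ℚ
  open import Data.Rational.Unnormalised using (mkℚᵘ; *≤*)
  import Data.Rational.Unnormalised as ℚᵘ
  import Data.Rational.Unnormalised.Properties as ℚᵘ

  -- The integer part of the `e`-th root, for positive `e`; passing from `n` to `suc n` raises it by
  -- at most one.
  root : ℕ → ℕ → ℕ
  root e zero = 0
  root e (suc n) with suc (root e n) ^ e ≤? suc n
  ... | yes _ = suc (root e n)
  ... | no  _ = root e n

  root^≤ : ∀ e .⦃ _ : NonZero e ⦄ n → root e n ^ e ≤ n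
  root^≤ (suc e) zero = z≤n
  root^≤ e (suc n) with suc (root e n) ^ e ≤? suc n
  ... | yes le = le
  ... | no  _  = m≤n⇒m≤1+n (root^≤ e n)

  <1+root^ : ∀ e .⦃ _ : NonZero e ⦄ n → n < suc (root e n) ^ e
  <1+root^ e zero = ≤-reflexive (sym (^-zeroˡ e))
  <1+root^ e (suc n) with suc (root e n) ^ e ≤? suc n
  ... | yes _  = ≤-<-trans (<1+root^ e n) (^-monoˡ-< e (n<1+n (suc (root e n))))
  ... | no  gt = ≰⇒> gt

  root-positive : ∀ e .⦃ _ : NonZero e ⦄ {n} → 1 ≤ n → 1 ≤ root e n
  root-positive e {n} 1≤n with root e n | <1+root^ e n
  ... | zero  | n<1 = contradiction (≤-trans n<1 (≤-trans (≤-reflexive (^-zeroˡ e)) 1≤n)) (<-irrefl refl)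
  ... | suc b | _   = s≤s z≤n

  root-unbounded : ∀ e .⦃ _ : NonZero e ⦄ c n → c ^ e ≤ n → c ≤ suc (root e n)
  root-unbounded e c n le with c ≤? suc (root e n)
  ... | yes c≤ = c≤
  ... | no  c≰ = contradiction (≤-trans (^-monoˡ-≤ e (<⇒≤ (≰⇒> c≰))) le) (<⇒≱ (<1+root^ e n))

  1+n≤2^n : ∀ n → suc n ≤ 2 ^ n
  1+n≤2^n zero    = ≤-refl
  1+n≤2^n (suc n) = ≤-trans (+-mono-≤ (≤-trans (s≤s z≤n) (1+n≤2^n n)) (1+n≤2^n n))
                      (≤-reflexive (cong (λ e → 2 ^ n + e) (sym (+-identityʳ (2 ^ n)))))

  -- A crude logarithm: with `b = root e n`, `n < (1 + b) ^ e ≤ 2 ^ (b * e)`. Linearly many phases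
  -- in `b` are affordable because each of them takes only about `n / b²` pebbles.
  square<2^ : ∀ e .⦃ _ : NonZero e ⦄ n → n * n < 2 ^ (root e n * e + root e n * e)
  square<2^ e n = subst (n * n <_) (sym (^-distribˡ-+-* 2 (root e n * e) (root e n * e))) (*-mono-< n<2^ n<2^)
    where
    n<2^ : n < 2 ^ (root e n * e)
    n<2^ = <-≤-trans (<1+root^ e n) (≤-trans (^-monoˡ-≤ e (1+n≤2^n (root e n))) (≤-reflexive (^-*-assoc 2 (root e n) e)))

  ≤-quotient : ∀ n d .⦃ _ : NonZero d ⦄ → n ≤ suc (n / d) * d
  ≤-quotient n d = ≤-trans (≤-reflexive (m≡m%n+[m/n]*n n d)) (+-monoˡ-≤ (n / d * d) (<⇒≤ (m%n<n n d)))

  -- With b = β n and d = b², balls of radius 6 in Γ have size O(b¹²) = O(n / b).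
  β : ℕ → ℕ
  β = root 14

  ^-distribʳ-* : ∀ e x y → (x * y) ^ e ≡ x ^ e * y ^ e
  ^-distribʳ-* zero    x y = refl
  ^-distribʳ-* (suc e) x y =
    trans (cong (x * y *_) (^-distribʳ-* e x y)) ([m*n]*[o*p]≡[m*o]*[n*p] x y (x ^ e) (y ^ e))

  abstract
    C : ℕ
    C = 12 + (6 * 3 ^ 6 + 112)

    -- The first factor bounds the pebbles beyond `n / 4`: a constant, three balls of radius 6, and
    -- the separating set. After estimating `1 + b` by `2 * b` and `1 + 2 * b²` by `3 * b²`, every
    -- term is a multiple of a quantity that is at most `n`, and `C` adds up the coefficients.
    overhead : ∀ {n b q} → 1 ≤ b → b ^ 14 ≤ n → q * (b * b) ≤ n →
      (6 + 3 * (1 + 2 * (b * b)) ^ 6 + (b * 14 + b * 14) * suc q) * suc b ≤ C * n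
    overhead {n} {b} {q} 1≤b b^14≤n qb²≤n = begin
      (6 + 3 * (1 + 2 * (b * b)) ^ 6 + (b * 14 + b * 14) * suc q) * suc b
        ≤⟨ *-mono-≤ (+-monoˡ-≤ _ (+-monoʳ-≤ 6 (*-monoʳ-≤ 3 (^-monoˡ-≤ 6 1+2b²≤3b²)))) 1+b≤2b ⟩
      (6 + 3 * (3 * (b * b)) ^ 6 + (b * 14 + b * 14) * suc q) * (2 * b)
        ≡⟨ cong (λ e → (6 + 3 * e + (b * 14 + b * 14) * suc q) * (2 * b)) (^-distribʳ-* 6 3 (b * b)) ⟩
      (6 + 3 * (3 ^ 6 * (b * b) ^ 6) + (b * 14 + b * 14) * suc q) * (2 * b)
        ≡⟨ expand b (3 ^ 6) ((b * b) ^ 6) q ⟩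
      12 * b + (6 * 3 ^ 6 * ((b * b) ^ 6 * b) + (56 * (q * (b * b)) + 56 * (b * b)))
        ≤⟨ +-mono-≤ (*-monoʳ-≤ 12 b≤n) (+-mono-≤ (*-monoʳ-≤ (6 * 3 ^ 6) b¹³≤n) (+-mono-≤ (*-monoʳ-≤ 56 qb²≤n) (*-monoʳ-≤ 56 b²≤n))) ⟩
      12 * n + (6 * 3 ^ 6 * n + (56 * n + 56 * n))
        ≡⟨ collect n (6 * 3 ^ 6) ⟩
      (12 + (6 * 3 ^ 6 + 112)) * n ∎
      where
      open ≤-Reasoning
      instance
        b≢0 : NonZero b
        b≢0 = >-nonZero 1≤b
      1+b≤2b : suc b ≤ 2 * b
      1+b≤2b = ≤-trans (+-monoˡ-≤ b 1≤b) (≤-reflexive (cong (λ e → b + e) (sym (+-identityʳ b))))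
      1+2b²≤3b² : 1 + 2 * (b * b) ≤ 3 * (b * b)
      1+2b²≤3b² = +-monoˡ-≤ (2 * (b * b)) (*-mono-≤ 1≤b 1≤b)
      expand : ∀ b t c q → (6 + 3 * (t * c) + (b * 14 + b * 14) * suc q) * (2 * b) ≡
                           12 * b + (6 * t * (c * b) + (56 * (q * (b * b)) + 56 * (b * b)))
      expand = solve-∀
      collect : ∀ n t → 12 * n + (t * n + (56 * n + 56 * n)) ≡ (12 + (t + 112)) * n
      collect = solve-∀
      ^≤n : ∀ j → j ≤ 14 → b ^ j ≤ n
      ^≤n j j≤ = ≤-trans (^-monoʳ-≤ b j≤) b^14≤n
      b≤n : b ≤ n
      b≤n = ≤-trans (≤-reflexive (sym (^-identityʳ b))) (^≤n 1 (m≤m+n 1 13))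
      b²≤n : b * b ≤ n
      b²≤n = ≤-trans (≤-reflexive (cong (b *_) (sym (*-identityʳ b)))) (^≤n 2 (m≤m+n 2 12))
      b¹³≤n : (b * b) ^ 6 * b ≤ n
      b¹³≤n = ≤-trans (≤-reflexive (trans (*-comm _ b) (cong (b *_) (trans (^-distribʳ-* 6 b b) (sym (^-distribˡ-+-* b 6 6)))))) (^≤n 13 (m≤m+n 13 1))

  g : ℕ → ℚ
  g n = (+ (C * n)) /ℚ suc (β n)

  toℚᵘ-/ : ∀ a b → toℚᵘ ((+ a) /ℚ suc b) ℚᵘ.≃ mkℚᵘ (+ a) b
  toℚᵘ-/ a b = ℚ.toℚᵘ-fromℚᵘ (mkℚᵘ (+ a) b)

  g-sublinear : ∀ (ε : ℚ) → 0ℚ <ℚ ε → ∃ λ N → ∀ n → N ≤ n → ∣ g n ∣ ≤ℚ ε *ℚ ((+ n) /ℚ 1)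
  g-sublinear (mkℚ -[1+ _ ] f c) lt with positive lt
  ... | ()
  g-sublinear (mkℚ (+ zero) f c) lt with positive lt
  ... | ()
  -- Here ε is `suc e / suc f`. From this bound on, `suc (β n)` is at least `C * suc f`, so `g n` is
  -- at most `n / suc f`.
  g-sublinear ε@(mkℚ (+ suc e) f c) lt = (C * suc f) ^ 14 , λ n N≤n →
    subst (_≤ℚ ε *ℚ ((+ n) /ℚ 1)) (sym (ℚ.0≤p⇒∣p∣≡p (ℚ.nonNegative⁻¹ (g n) ⦃ ℚ.normalize-nonNeg (C * n) (suc (β n)) ⦄)))
      (ℚ.toℚᵘ-cancel-≤ (begin
        toℚᵘ (g n)                                ≃⟨ toℚᵘ-/ (C * n) (β n) ⟩
        mkℚᵘ (+ (C * n)) (β n)                    ≤⟨ *≤* (bound n (root-unbounded 14 (C * suc f) n N≤n)) ⟩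
        mkℚᵘ (+ suc e) f ℚᵘ.* mkℚᵘ (+ n) 0        ≃⟨ ℚᵘ.*-congˡ {mkℚᵘ (+ suc e) f} (ℚᵘ.≃-sym (toℚᵘ-/ n 0)) ⟩
        toℚᵘ ε ℚᵘ.* toℚᵘ ((+ n) /ℚ 1)             ≃⟨ ℚ.toℚᵘ-homo-* ε ((+ n) /ℚ 1) ⟨
        toℚᵘ (ε *ℚ ((+ n) /ℚ 1))                  ∎))
    where
    open ℚᵘ.≤-Reasoning
    nat : ∀ n b → C * suc f ≤ suc b → C * n * (suc f * 1) ≤ suc e * n * suc b
    nat n b le = ≤-trans (≤-reflexive (regroup C n (suc f)))
      (≤-trans (*-mono-≤ (m≤m+n n (e * n)) le) ≤-refl)
      where
      regroup : ∀ c n f → c * n * (f * 1) ≡ n * (c * f)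
      regroup = solve-∀
    bound : ∀ n → C * suc f ≤ suc (β n) →
            (+ (C * n)) ℤ.* (+ (suc f * 1)) ℤ.≤ (+ suc e ℤ.* + n) ℤ.* + suc (β n)
    bound n le = subst₂ ℤ._≤_ (ℤ.pos-* (C * n) (suc f * 1))
      (trans (ℤ.pos-* (suc e * n) (suc (β n))) (cong (ℤ._* + suc (β n)) (ℤ.pos-* (suc e) n)))
      (+≤+ (nat n (β n) le))

  ≤-n/4+g : ∀ k n → 4 * k * suc (β n) ≤ n * suc (β n) + C * n * 4 → ((+ k) /ℚ 1) ≤ℚ (((+ n) /ℚ 4) +ℚ g n)
  ≤-n/4+g k n le = ℚ.toℚᵘ-cancel-≤ (begin
    toℚᵘ ((+ k) /ℚ 1)                               ≃⟨ toℚᵘ-/ k 0 ⟩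
    mkℚᵘ (+ k) 0                                    ≤⟨ *≤* bound ⟩
    mkℚᵘ (+ n) 3 ℚᵘ.+ mkℚᵘ (+ (C * n)) (β n)        ≃⟨ ℚᵘ.+-cong (ℚᵘ.≃-sym (toℚᵘ-/ n 3)) (ℚᵘ.≃-sym (toℚᵘ-/ (C * n) (β n))) ⟩
    toℚᵘ ((+ n) /ℚ 4) ℚᵘ.+ toℚᵘ (g n)               ≃⟨ ℚ.toℚᵘ-homo-+ ((+ n) /ℚ 4) (g n) ⟨
    toℚᵘ (((+ n) /ℚ 4) +ℚ g n)                      ∎)
    where
    open ℚᵘ.≤-Reasoning
    regroup : ∀ k b → k * (4 * b) ≡ 4 * k * b
    regroup = solve-∀
    nat : k * (4 * suc (β n)) ≤ (n * suc (β n) + C * n * 4) * 1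
    nat = ≤-trans (≤-reflexive (regroup k (suc (β n)))) (≤-trans le (≤-reflexive (sym (*-identityʳ _))))
    bound : (+ k) ℤ.* (+ (4 * suc (β n))) ℤ.≤ (+ n ℤ.* + suc (β n) ℤ.+ + (C * n) ℤ.* + 4) ℤ.* + 1
    bound = subst₂ ℤ._≤_ (ℤ.pos-* k (4 * suc (β n)))
      (trans (ℤ.pos-* (n * suc (β n) + C * n * 4) 1) (cong (ℤ._* + 1)
        (trans (ℤ.pos-+ (n * suc (β n)) (C * n * 4)) (cong₂ ℤ._+_ (ℤ.pos-* n (suc (β n))) (ℤ.pos-* (C * n) 4)))))
      (+≤+ nat)

-- Choice of parameters and conclusion.

open Counting using (separating-set)
open Structure
open Asymptotics
open import Data.Integer using (+_)
open import Data.Rational using (ℚ; _/_; _+_; _*_; ∣_∣; 0ℚ) renaming (_≤_ to _≤ℚ_; _<_ to _<ℚ_)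


-- The greedy set `s` is grown from the separating set `t`. Vertices equivalent over `s` have the
-- same adjacencies to `t`, so their neighbourhoods differ in at most `d` places, as the degree
-- bound for Γ requires.
identified : ∀ {m} ne (G : Graph (suc m)) {H} d q h f K → suc m ≤ q ℕ.* d → suc m ℕ.* suc m < 2 ℕ.^ h →
  suc m < 4 ℕ.* suc f → 3 ℕ.* (1 ℕ.+ 2 ℕ.* d) ℕ.^ 6 ℕ.+ (4 ℕ.+ (f ℕ.+ h ℕ.* q)) ≤ K →
  GameEquivalence (toColored ne G) H K → Iso (toColored ne G) H
identified ne G d q h f K n≤qd n²<2^h quarter room ge =
  let t , t≤ , separates = separating-set (Graph.adj G) d q h n≤qd n²<2^h
      s , s≤ , t⊆s , stuck = greedy f t (<-≤-trans quarter (m≤n+m _ (#classes (types t))))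
      length-s = ≤-trans s≤ (+-monoʳ-≤ f t≤)
      room₄ = ≤-trans (+-monoʳ-≤ 4 (≤-trans (≤-reflexive (length-map _ s)) length-s)) room′
      p , p≡s , good = pebble {false} {[]} s
        (≤-trans (≤-reflexive (+-identityʳ _)) (≤-trans length-s (≤-trans (m≤n+m _ 4) room′))) (good-[] false)
      length-p = ≤-trans (≤-reflexive (trans (sym (length-map proj₁ p)) (cong length p≡s))) length-s
  in Match.isomorphism ge s room₄ d
       (λ x y x~y → separates x y (λ z z∈ → good-adj (≤-trans (+-monoˡ-≤ _ (s≤s z≤n)) room₄) x~y
                      (there (∈-map⁺ (λ v → v , v) (t⊆s z∈))) (here refl)))
       stuck p p≡s (subst (Good false) (++-identityʳ p) good) ((1 ℕ.+ 2 ℕ.* d) ℕ.^ 6) ≤-refl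
       (≤-trans (+-monoʳ-≤ (3 ℕ.* (1 ℕ.+ 2 ℕ.* d) ℕ.^ 6) (+-mono-≤ (n≤1+n 3) length-p)) room)
  where
  open Types ge
  room′ : 4 ℕ.+ (f ℕ.+ h ℕ.* q) ≤ K
  room′ = ≤-trans (m≤n+m _ (3 ℕ.* (1 ℕ.+ 2 ℕ.* d) ℕ.^ 6)) room

budget : ∀ {n f x y b a} → f ℕ.* 4 ≤ n → (6 ℕ.+ x ℕ.+ y) ℕ.* b ≤ a →
  4 ℕ.* (2 ℕ.+ (x ℕ.+ (4 ℕ.+ (f ℕ.+ y)))) ℕ.* b ≤ n ℕ.* b ℕ.+ a ℕ.* 4
budget {n} {f} {x} {y} {b} {a} 4f≤n le =
  ≤-trans (≤-reflexive (regroup x f y b)) (+-mono-≤ (*-monoˡ-≤ b 4f≤n) (*-monoˡ-≤ 4 le))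
  where
  regroup : ∀ x f y b → 4 ℕ.* (2 ℕ.+ (x ℕ.+ (4 ℕ.+ (f ℕ.+ y)))) ℕ.* b ≡ f ℕ.* 4 ℕ.* b ℕ.+ (6 ℕ.+ x ℕ.+ y) ℕ.* b ℕ.* 4
  regroup = solve-∀

<4*[1+n/4] : ∀ n → n < 4 ℕ.* suc (n ℕ./ 4)
<4*[1+n/4] n = ≤-trans (s≤s (≤-reflexive (m≡m%n+[m/n]*n n 4)))
  (≤-trans (+-monoˡ-≤ (n ℕ./ 4 ℕ.* 4) (m%n<n n 4)) (≤-reflexive (*-comm (suc (n ℕ./ 4)) 4)))

wl-dimension : ∀ {n} ne (G : Graph n) b → 1 ≤ b → b ℕ.^ 14 ≤ n → n ℕ.* n < 2 ℕ.^ (b ℕ.* 14 ℕ.+ b ℕ.* 14) →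
  ∃ λ K → (∀ {H} → GameEquivalence (toColored ne G) H K → Iso (toColored ne G) H) ×
          4 ℕ.* suc (suc K) ℕ.* suc b ≤ n ℕ.* suc b ℕ.+ C ℕ.* n ℕ.* 4
wl-dimension {suc m} ne G b 1≤b b^14≤n n²<2^h = K ,
  identified ne G d (suc q) h f K (≤-quotient (suc m) d) n²<2^h (<4*[1+n/4] (suc m)) ≤-refl ,
  budget {f = f} {3 ℕ.* (1 ℕ.+ 2 ℕ.* d) ℕ.^ 6} {h ℕ.* suc q}
    (m/n*n≤m (suc m) 4) (overhead {suc m} {b} {q} 1≤b b^14≤n (m/n*n≤m (suc m) d))
  where
  d f q h K : ℕ
  d = b ℕ.* b
  h = b ℕ.* 14 ℕ.+ b ℕ.* 14
  instance
    d≢0 : NonZero d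
    d≢0 = >-nonZero (*-mono-≤ 1≤b 1≤b)
  f = suc m ℕ./ 4
  q = suc m ℕ./ d
  K = 3 ℕ.* (1 ℕ.+ 2 ℕ.* d) ℕ.^ 6 ℕ.+ (4 ℕ.+ (f ℕ.+ h ℕ.* suc q))

theorem1 : Σ (ℕ → ℚ) λ g →
    (∀ (ε : ℚ) → 0ℚ <ℚ ε → ∃ λ N → ∀ n → N ≤ n → ∣ g n ∣ ≤ℚ ε * ((+ n) / 1)) ×
    (∀ (n : ℕ) (ne : 1 ≤ n) (G : Graph n) →
    ∃ λ k → (1 ≤ k) × Identifies k (toColored ne G) × (((+ k) / 1) ≤ℚ (((+ n) / 4) + g n)))
theorem1 = g , g-sublinear , λ n ne G →
  let K , identified , bound = wl-dimension ne G (β n) (root-positive 14 ne) (root^≤ 14 n) (square<2^ 14 n)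
  -- The two positions beyond `K` are those reserved for padding and overwriting. The goal after
  -- `same` is absurdity, so a double negated game equivalence is enough.
  in suc (suc K) , s≤s z≤n ,
     (λ H ¬iso → stableRound (suc (suc K)) (toColored ne G) H , λ same →
        ¬¬-gameEquivalence K (toColored ne G) H same (λ ge → ¬iso (identified ge))) ,
     ≤-n/4+g (suc (suc K)) n bound
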